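{- For any integer $g\ge 3$ and any positive integer $m$, there exist cubic graphs $G$ and $A$ such that $H=G\circ A^-$ is a $3$-connected cubic graph of girth at least $g$ with \[c_2(H)-\left\lceil\frac{|V(H)|+2}{4}\right\rceil\ge m.\] Moreover, $H$ is Class $1$ if and only if $G$ and $A$ are Class $1$.
   Context: A cubic graph is Class $1$ if its chromatic index is $3$ and Class $2$ if it is $4$. Let $G$ and $A$ be $3$-regular graphs, let $a$ be a vertex of $A$ and $A^-=A-a$. A graph $G\circ A^-$ is any graph obtained by replacing each vertex $v$ of $G$ by a copy $A^-_v$ of $A^-$ and, for each edge $uv$ of $G$, adding an edge joining a vertex of degree $2$ of $A^-_u$ to a vertex of degree $2$ of $A^-_v$, so that each degree-$2$ vertex of each copy is incident with exactly one added edge. For a graph $H=(V,E)$ and $S_0\subseteq V$, the irreversible $2$-threshold conversion process sets $S_t=S_{t-1}\cup\{v: v \text{ has at least } 2 \text{ neighbours in } S_{t-1}\}$ for $t\ge 1$; $S_0$ is a $2$-conversion set if $S_t=V$ for some $t$, and $c_2(H)$ is the minimum size of a $2$-conversion set. -}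

module Defs where

open import Data.Fin using (Fin; zero; suc; inject₁; fromℕ; punchIn; quotient; remainder)
open import Data.Fin.Properties using (_≟_)
open import Data.Fin.Subset using (Subset; _∉_; _∩_; _∪_; ∣_∣; ⊤)
open import Data.Nat using (ℕ; zero; suc; _*_; _≤_; _<_; _≤?_)
open import Data.Product using (Σ-syntax; ∃-syntax; ∃!; _×_; _,_)
open import Data.Sum using (_⊎_; inj₁; inj₂)
open import Data.Vec using (tabulate)
open import Function.Definitions using (Injective)
open import Relation.Binary.Construct.Closure.ReflexiveTransitive using (Star)
open import Relation.Binary.Definitions using (Decidable; Symmetric)
open import Relation.Binary.PropositionalEquality using (_≡_; _≢_; sym)
open import Relation.Nullary.Decidable using (does; _×-dec_; _⊎-dec_)
open import Relation.Nullary.Negation using (¬_)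

-- Finite simple graphs on the vertex set Fin n.
record Graph (n : ℕ) : Set₁ where
  field
    _~_    : Fin n → Fin n → Set
    _~?_   : Decidable _~_
    ~-sym  : Symmetric _~_
    ~-irr  : ∀ {v} → ¬ (v ~ v)

  neighbours : Fin n → Subset n
  neighbours v = tabulate (λ u → does (v ~? u))

  degree : Fin n → ℕ
  degree v = ∣ neighbours v ∣

Cubic : ∀ {n} → Graph n → Set
Cubic G = ∀ v → Graph.degree G v ≡ 3

IsLeast : (ℕ → Set) → ℕ → Set
IsLeast P k = P k × (∀ j → P j → k ≤ j)

-- Only pairs of distinct neighbours are required to differ, while `symmetric`
-- compares arbitrary adjacency proofs: a colour therefore depends only on the
-- undirected edge, even if _~_ has several proofs for the same pair.
record EdgeColouring {n : ℕ} (G : Graph n) (k : ℕ) : Set where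
  open Graph G
  field
    colour    : ∀ {u v} → u ~ v → Fin k
    symmetric : ∀ {u v} (p : u ~ v) (q : v ~ u) → colour p ≡ colour q
    proper    : ∀ {u v w} (p : u ~ v) (q : u ~ w) → v ≢ w → colour p ≢ colour q

ChromaticIndex : ∀ {n} → Graph n → ℕ → Set
ChromaticIndex G = IsLeast (EdgeColouring G)

Class1 : ∀ {n} → Graph n → Set
Class1 G = ChromaticIndex G 3

-- A walk from u to v in the graph obtained by deleting the vertices of S.
Walk-avoiding : ∀ {n} → Graph n → Subset n → Fin n → Fin n → Set
Walk-avoiding G S = Star (λ x y → x ∉ S × y ∉ S × x ~ y)
  where open Graph G

Connected-without : ∀ {n} → Graph n → Subset n → Set
Connected-without G S = ∀ u v → u ∉ S → v ∉ S → Walk-avoiding G S u v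

KConnected : ∀ {n} → ℕ → Graph n → Set
KConnected {n} k G = k < n × (∀ S → ∣ S ∣ < k → Connected-without G S)

-- A cycle vertex 0, vertex 1, …, vertex l, of length suc l.
data Cycle {n : ℕ} (G : Graph n) : ℕ → Set where
  cycle : ∀ {l} (vertex : Fin (suc l) → Fin n) → 3 ≤ suc l →
          Injective _≡_ _≡_ vertex →
          (∀ (i : Fin l) → Graph._~_ G (vertex (inject₁ i)) (vertex (suc i))) →
          Graph._~_ G (vertex (fromℕ l)) (vertex zero) →
          Cycle G (suc l)

-- The girth is the length of a shortest cycle (infinite if there is none).
GirthAtLeast : ∀ {n} → ℕ → Graph n → Set
GirthAtLeast g G = ∀ l → Cycle G l → g ≤ l

module _ {n : ℕ} (G : Graph n) where
  open Graph G

  step : Subset n → Subset n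
  step S = S ∪ tabulate (λ v → does (2 ≤? ∣ neighbours v ∩ S ∣))

  process : Subset n → ℕ → Subset n
  process S₀ zero    = S₀
  process S₀ (suc t) = step (process S₀ t)

  ConversionSet : Subset n → Set
  ConversionSet S₀ = ∃[ t ] process S₀ t ≡ ⊤

  -- IsC₂ c says that c = c₂(G).
  IsC₂ : ℕ → Set
  IsC₂ = IsLeast (λ c → Σ[ S ∈ Subset n ] ConversionSet S × ∣ S ∣ ≡ c)

-- The vertex i of A ∖ a is the vertex punchIn a i of A.
_∖_ : ∀ {k} → Graph (suc k) → Fin (suc k) → Graph k
A ∖ a = record
  { _~_   = λ i j → punchIn a i ~ punchIn a j
  ; _~?_  = λ i j → punchIn a i ~? punchIn a j
  ; ~-sym = ~-sym
  ; ~-irr = ~-irr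
  }
  where open Graph A

-- The choice of added edges: the edge uv of G gives rise to the edge joining
-- the vertex port u v of the copy at u to the vertex port v u of the copy at v.
-- The value of port u v is irrelevant when u and v are not adjacent in G.
record Linking {n k : ℕ} (G : Graph n) (B : Graph k) : Set where
  open Graph G using (_~_)
  open Graph B using (degree)
  field
    port        : Fin n → Fin n → Fin k
    port-degree : ∀ {u v} → u ~ v → degree (port u v) ≡ 2
    port-unique : ∀ u x → degree x ≡ 2 → ∃! _≡_ (λ v → u ~ v × port u v ≡ x)

-- G ∘ A⁻ for B = A⁻ and the given added edges.  A vertex i of the result is
-- the vertex remainder k i of the copy of B replacing the vertex quotient k i of G.
compose : ∀ {n k} (G : Graph n) (B : Graph k) → Linking G B → Graph (n * k)
compose {n} {k} G B L = record
  { _~_   = λ i j → (at i ≡ at j × pos i B.~ pos j)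
                  ⊎ (at i G.~ at j × port (at i) (at j) ≡ pos i × port (at j) (at i) ≡ pos j)
  ; _~?_  = λ i j → ((at i ≟ at j) ×-dec (pos i B.~? pos j))
            ⊎-dec ((at i G.~? at j) ×-dec ((port (at i) (at j) ≟ pos i) ×-dec (port (at j) (at i) ≟ pos j)))
  ; ~-sym = λ { (inj₁ (e , p))     → inj₁ (sym e , B.~-sym p)
              ; (inj₂ (p , e , f)) → inj₂ (G.~-sym p , f , e) }
  ; ~-irr = λ { (inj₁ (_ , p))     → B.~-irr p
              ; (inj₂ (p , _))     → G.~-irr p }
  }
  where
  module G = Graph G
  module B = Graph B
  open Linking L
  at : Fin (n * k) → Fin n
  at = quotient k
  pos : Fin (n * k) → Fin k
  pos = remainder {n} k

-- For the chromatic part, a 3-edge-colouring of G ∘ A⁻ restricted to a copy of A⁻ is a colouring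
-- of A that is proper except perhaps at a; by parity it is proper at a too, so the three edges
-- leaving a copy have distinct colours. Conversely, the colours of A can be permuted in each copy
-- so as to match those of G.
--
-- For the existence part, take G = A with a 3-edge-colouring, given by three involutions. Iterated
-- ℤ/2-homology covers produce involutions on a finite set such that no short reduced word has a
-- fixed point and each product of two of them has order dividing N = 2^g; this gives large girth.
-- Multiplying by three copies of the 2N-cycle, on which one involution acts trivially and the
-- others by its alternate edges, forces bicoloured cycles with different colour pairs to meet in at
-- most an edge. A component is then 3-connected, because a removed vertex can be bypassed along
-- bicoloured cycles, and its order n = k + 1 is divisible by 4, say k = 4 j + 3. In a copy of A⁻
-- the vertices outside a conversion set span a forest, so counting edges puts at least j + 1
-- members of the conversion set in every copy. Hence 4 c₂(H) ≥ n (k + 1), which exceeds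
-- |V(H)| + 2 = n k + 2 by n − 2.

module Submission where

open import Defs
open import Data.Bool using (Bool; true; false; not; _∧_; _xor_)
import Data.Bool.Properties as Bool
open import Data.Fin using (Fin; zero; suc; punchIn; punchOut; combine; quotient; remainder; toℕ; fromℕ; fromℕ<; inject₁; _↑ˡ_; _↑ʳ_)
open import Data.Fin.Permutation using (permutation)
open import Data.Fin.Permutation.Components using (transpose; transpose-inverse)
open import Data.Fin.Properties using (_≟_; any?; remQuot-combine; combine-remQuot; punchIn-injective; punchInᵢ≢i; punchIn-punchOut; punchOut-injective; injective⇒≤; combine-injective; combine-injectiveˡ; combine-injectiveʳ; toℕ-injective; toℕ-fromℕ<; toℕ<n) renaming (suc-injective to Fin-suc-injective)
open import Data.Fin.Subset using (Subset; _∈_; _∉_; _⊆_; _∩_; _∪_; ∣_∣; ⊤; ⁅_⁆)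
open import Data.Fin.Subset.Properties using (_∈?_; p⊆p∪q; x∈p∪q⁻; x∈p∪q⁺; ⊆-trans; ⊆-antisym; ⊆-max; ⊆-reflexive; ∣p∣≤n; ∣p∣≡n⇒p≡⊤; p⊂q⇒∣p∣<∣q∣; anySubset?; ∈⊤; x∈⁅x⁆; x∈⁅y⁆⇒x≡y)
import Data.Integer as ℤ
import Data.Integer.DivMod as ℤ
import Data.Integer.Properties as ℤ
open import Data.List using (List; []; _∷_; _++_; length)
open import Data.List.Properties using (length-++)
open import Data.List.Relation.Unary.Linked using (Linked; []; [-]; _∷_)
open import Data.Nat using (ℕ; zero; suc; _+_; _*_; _∸_; _^_; _≤_; _<_; _≥_; z≤n; s≤s; NonZero; _%_; >-nonZero⁻¹)
open import Data.Nat.Divisibility using (_∣_; divides; ∣m∣n⇒∣m+n; ∣m+n∣m⇒∣n; ∣⇒≤)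
open import Data.Nat.DivMod using (m%n<n; %-distribˡ-+; m%n%n≡m%n; [m+n]%n≡m%n; [m+kn]%n≡m%n; m<n⇒m%n≡m)
open import Data.Nat.Properties renaming (_≟_ to _≟ℕ_)
open import Data.Nat.Tactic.RingSolver using (solve-∀)
open import Data.Product using (Σ-syntax; ∃; ∃-syntax; ∃!; _×_; _,_; proj₁; proj₂)
open import Data.Rational.Unnormalised using (_/_; ceiling)
open import Data.Sum using (_⊎_; inj₁; inj₂)
open import Data.Vec using (Vec; []; _∷_; zipWith; lookup; tabulate; replicate)
open import Data.Vec.Properties using (≡-dec; zipWith-assoc; zipWith-comm; zipWith-identityʳ; lookup-zipWith; lookup∘tabulate; []=⇒lookup; lookup⇒[]=)
open import Function using (_∘_; id)
open import Function.Bundles using (_⇔_; mk⇔)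
open import Function.Definitions using (Injective)
open import Relation.Binary.Construct.Closure.ReflexiveTransitive using (Star; ε; _◅_; _◅◅_; reverse)
open import Relation.Binary.Definitions using (tri<; tri≈; tri>)
open import Relation.Binary.PropositionalEquality using (_≡_; _≢_; refl; sym; trans; cong; cong₂; subst; subst₂; ≢-sym; module ≡-Reasoning)
open import Relation.Nullary using (¬_; Dec; yes; no; does; contradiction)
open import Relation.Nullary.Decidable using (dec-true; dec-false; does-⇔; map′; decidable-stable; ¬?; _×-dec_; _⊎-dec_)
open import Relation.Unary using (Decidable)
open import Algebra.Properties.CommutativeMonoid.Sum +-0-commutativeMonoid using (sum; sum-cong-≗; sum-remove; ∑-distrib-+; ∑-comm; sum-replicate-zero; sum-permute)

-- Finite sums and enumerations

-- The edge count in one copy yields only `4 s ≥ k − 1` for its `s` members of the conversion set;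
-- summed over the copies this falls short of `n k + 2`. The excess comes from rounding: when `k` is
-- 3 modulo 4, the integer `s` is at least `(k + 1) / 4`. That is what divisibility of the order by
-- 4 is for, and since the gain is made once per copy, a large order turns it into an arbitrary gap.
--
-- Why bicoloured cycles meet so little: let `r` be the third colour besides `p` and `q`. A turn
-- along `p` and `q` has order dividing `N`, while it moves label `r` with order exactly `N`; hence
-- a pq-cycle maps bijectively onto the 2N-cycle of label `r`. A cycle in the colours `p` and `r`
-- shows only two values of that label, as `r` fixes it, so inside the pq-cycle it can meet only the
-- two ends of one p-edge.
--
-- The powers of two come from the covers: running twice round a cycle cancels all toggles, so each
-- cover at most doubles the order of a turn.

χ : Bool → ℕ
χ true  = 1
χ false = 0

∣tabulate∣ : ∀ {n} (f : Fin n → Bool) → ∣ tabulate f ∣ ≡ sum (χ ∘ f)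
∣tabulate∣ {zero}  f = refl
∣tabulate∣ {suc n} f with f zero
... | true  = cong suc (∣tabulate∣ (f ∘ suc))
... | false = ∣tabulate∣ (f ∘ suc)

∣_∣-sum : ∀ {n} (S : Subset n) → ∣ S ∣ ≡ sum (χ ∘ lookup S)
∣ []        ∣-sum = refl
∣ true ∷ S  ∣-sum = cong suc ∣ S ∣-sum
∣ false ∷ S ∣-sum = ∣ S ∣-sum

sum-mono : ∀ {n} {f g : Fin n → ℕ} → (∀ i → f i ≤ g i) → sum f ≤ sum g
sum-mono {zero}  f≤g = z≤n
sum-mono {suc n} f≤g = +-mono-≤ (f≤g zero) (sum-mono (f≤g ∘ suc))

term≤sum : ∀ {n} (f : Fin n → ℕ) i → f i ≤ sum f
term≤sum f zero    = m≤m+n _ _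
term≤sum f (suc i) = ≤-trans (term≤sum (f ∘ suc) i) (m≤n+m _ (f zero))

sum-const : ∀ n c → sum {n} (λ _ → c) ≡ n * c
sum-const zero    c = refl
sum-const (suc n) c = cong (c +_) (sum-const n c)

sum-zero : ∀ {n} {f : Fin n → ℕ} → (∀ i → f i ≡ 0) → sum f ≡ 0
sum-zero {n} f≡0 = trans (sum-cong-≗ f≡0) (sum-replicate-zero n)

*-distribˡ-sum : ∀ {n} c (f : Fin n → ℕ) → sum (λ i → c * f i) ≡ c * sum f
*-distribˡ-sum {zero}  c f = sym (*-zeroʳ c)
*-distribˡ-sum {suc n} c f = trans (cong (c * f zero +_) (*-distribˡ-sum c (f ∘ suc))) (sym (*-distribˡ-+ c (f zero) _))

sum-single : ∀ {n} (i : Fin n) (f : Fin n → ℕ) → sum (λ j → χ (does (i ≟ j)) * f j) ≡ f i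
sum-single {suc n} i f = begin
  sum t                                        ≡⟨ sum-remove {i = i} t ⟩
  t i + sum (λ j → t (punchIn i j))            ≡⟨ cong₂ _+_ (cong (λ b → χ b * f i) (dec-true (i ≟ i) refl)) (sum-zero off) ⟩
  1 * f i + 0                                  ≡⟨ +-identityʳ _ ⟩
  1 * f i                                      ≡⟨ *-identityˡ _ ⟩
  f i                                          ∎
  where
  open ≡-Reasoning
  t : Fin (suc n) → ℕ
  t j = χ (does (i ≟ j)) * f j
  off : ∀ j → t (punchIn i j) ≡ 0
  off j = cong (λ b → χ b * f (punchIn i j)) (dec-false (i ≟ punchIn i j) (≢-sym (punchInᵢ≢i i j)))

sum-δ : ∀ {n} (i : Fin n) → sum (λ j → χ (does (i ≟ j))) ≡ 1
sum-δ i = trans (sum-cong-≗ (λ j → sym (*-identityʳ (χ (does (i ≟ j)))))) (sum-single i (λ _ → 1))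

sum-++ : ∀ m {n} (f : Fin (m + n) → ℕ) → sum f ≡ sum (λ i → f (i ↑ˡ n)) + sum (λ j → f (m ↑ʳ j))
sum-++ zero    f = refl
sum-++ (suc m) f = trans (cong (f zero +_) (sum-++ m (f ∘ suc))) (sym (+-assoc (f zero) _ _))

sum-combine : ∀ n k (f : Fin (n * k) → ℕ) → sum f ≡ sum (λ u → sum (λ i → f (combine {n} {k} u i)))
sum-combine zero    k f = refl
sum-combine (suc n) k f = trans (sum-++ k f) (cong (sum (λ i → f (i ↑ˡ n * k)) +_) (sum-combine n k (λ j → f (k ↑ʳ j))))

-- A bijection of `Fin m` with the support of `f`. Degrees are used in this form: degree 3 becomes
-- three listed neighbours, and a list of neighbours computes a degree.
record Enumeration {n} (f : Fin n → Bool) (m : ℕ) : Set where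
  field
    elem      : Fin m → Fin n
    injective : Injective _≡_ _≡_ elem
    sound     : ∀ c → f (elem c) ≡ true
    complete  : ∀ i → f i ≡ true → ∃[ c ] elem c ≡ i

enumerate : ∀ {n} (f : Fin n → Bool) → Enumeration f (sum (χ ∘ f))
enumerate {zero}  f = record { elem = λ () ; injective = λ { {()} } ; sound = λ () ; complete = λ () }
enumerate {suc n} f with f zero in eq | enumerate (f ∘ suc)
... | true | e = record { elem = elem′ ; injective = inj′ ; sound = λ { zero → eq ; (suc c) → sound c }
    ; complete = λ { zero _ → zero , refl ; (suc i) t → let c , p = complete i t in suc c , cong suc p } }
  where
  open Enumeration e
  elem′ : Fin (suc _) → Fin (suc n)
  elem′ zero    = zero
  elem′ (suc c) = suc (elem c)
  inj′ : Injective _≡_ _≡_ elem′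
  inj′ {zero}  {zero}  _ = refl
  inj′ {zero}  {suc d} ()
  inj′ {suc c} {zero}  ()
  inj′ {suc c} {suc d} p = cong suc (injective (Fin-suc-injective p))
... | false | e = record { elem = suc ∘ elem ; injective = injective ∘ Fin-suc-injective ; sound = sound
    ; complete = λ { zero t → contradiction (trans (sym t) eq) λ () ; (suc i) t → let c , p = complete i t in c , cong suc p } }
  where open Enumeration e

-- Counts the pairs `(c , i)` with `elem c ≡ i` in two ways.
enumeration-size : ∀ {n m} {f : Fin n → Bool} → Enumeration f m → sum (χ ∘ f) ≡ m
enumeration-size {n} {m} {f} e = begin
  sum (χ ∘ f)                                            ≡⟨ sum-cong-≗ pointwise ⟩
  sum (λ i → sum (λ c → χ (does (elem c ≟ i))))          ≡⟨ ∑-comm (λ i c → χ (does (elem c ≟ i))) ⟩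
  sum (λ c → sum (λ i → χ (does (elem c ≟ i))))          ≡⟨ sum-cong-≗ (λ c → sum-δ (elem c)) ⟩
  sum {m} (λ _ → 1)                                      ≡⟨ sum-const m 1 ⟩
  m * 1                                                  ≡⟨ *-identityʳ m ⟩
  m                                                      ∎
  where
  open ≡-Reasoning
  open Enumeration e
  δ-elem : ∀ c d → does (c ≟ d) ≡ does (elem d ≟ elem c)
  δ-elem c d with c ≟ d
  ... | yes refl = sym (dec-true (elem c ≟ elem c) refl)
  ... | no c≢d   = sym (dec-false (elem d ≟ elem c) (λ p → c≢d (sym (injective p))))
  pointwise : ∀ i → χ (f i) ≡ sum (λ c → χ (does (elem c ≟ i)))
  pointwise i with f i in eq
  ... | true with c , refl ← complete i eq =
    sym (trans (sum-cong-≗ (λ d → cong χ (sym (δ-elem c d)))) (sum-δ c))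
  ... | false = sym (sum-zero λ c → cong χ (dec-false (elem c ≟ i) λ { refl → contradiction (trans (sym eq) (sound c)) λ () }))

-- The handshake lemma for a weighted adjacency matrix. Row and column zero contribute the same
-- amount, and induction handles the remaining minor.
symmetric-sum-even : ∀ {n} (M : Fin n → Fin n → ℕ) → (∀ i j → M i j ≡ M j i) → (∀ i → M i i ≡ 0) →
                     2 ∣ sum (λ i → sum (M i))
symmetric-sum-even {zero}  M M-sym M-diag = divides 0 refl
symmetric-sum-even {suc n} M M-sym M-diag = subst (2 ∣_) (sym split) (∣m∣n⇒∣m+n (divides r (*-comm 2 r)) (symmetric-sum-even (λ i j → M (suc i) (suc j)) (λ i j → M-sym _ _) (λ i → M-diag _)))
  where
  open ≡-Reasoning
  r = sum (λ j → M zero (suc j))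
  rest = sum (λ i → sum (λ j → M (suc i) (suc j)))
  split : sum (λ i → sum (M i)) ≡ 2 * r + rest
  split = begin
    M zero zero + r + sum (λ i → M (suc i) zero + sum (λ j → M (suc i) (suc j)))
      ≡⟨ cong₂ (λ a b → a + r + b) (M-diag zero) (∑-distrib-+ (λ i → M (suc i) zero) _) ⟩
    r + (sum (λ i → M (suc i) zero) + rest)
      ≡⟨ cong (λ a → r + (a + rest)) (sum-cong-≗ (λ i → M-sym (suc i) zero)) ⟩
    r + (r + rest)
      ≡⟨ sym (+-assoc r r rest) ⟩
    r + r + rest
      ≡⟨ cong (λ a → r + a + rest) (sym (+-identityʳ r)) ⟩
    2 * r + rest ∎

-- Edge colourings of cubic graphs

does⇒ : ∀ {P : Set} (d : Dec P) → does d ≡ true → P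
does⇒ (yes p) _ = p

-- A missed value could be punched out, which would inject `Fin (suc n)` into `Fin n`.
injective⇒surjective : ∀ {n} {f : Fin n → Fin n} → Injective _≡_ _≡_ f → ∀ y → ∃[ x ] f x ≡ y
injective⇒surjective {suc n} {f} f-inj y with any? (λ x → f x ≟ y)
... | yes found = found
... | no missed = contradiction (injective⇒≤ (f-inj ∘ punchOut-injective (y≢f _) (y≢f _))) 1+n≰n
  where
  y≢f : ∀ x → y ≢ f x
  y≢f x y≡fx = missed (x , sym y≡fx)

sum-ones-off : ∀ {n} (f : Fin n → ℕ) a → (∀ v → v ≢ a → f v ≡ 1) → suc (sum f) ≡ n + f a
sum-ones-off {suc m} f a f≡1 = begin
  suc (sum f)                                ≡⟨ cong suc (sum-remove {i = a} f) ⟩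
  suc (f a + sum (λ v → f (punchIn a v)))    ≡⟨ cong (λ x → suc (f a + x)) (trans (sum-cong-≗ (λ v → f≡1 (punchIn a v) (punchInᵢ≢i a v))) (sum-const m 1)) ⟩
  suc (f a + m * 1)                          ≡⟨ cong suc (trans (cong (f a +_) (*-identityʳ m)) (+-comm (f a) m)) ⟩
  suc m + f a                                ∎
  where open ≡-Reasoning

degree-sum : ∀ {n} (G : Graph n) v → Graph.degree G v ≡ sum (λ u → χ (does (Graph._~?_ G v u)))
degree-sum G v = ∣tabulate∣ (λ u → does (Graph._~?_ G v u))

neighbour-enumeration : ∀ {n} (G : Graph n) → Cubic G → ∀ v → Enumeration (λ u → does (Graph._~?_ G v u)) 3
neighbour-enumeration G cubic v = subst (Enumeration _) (trans (sym (degree-sum G v)) (cubic v)) (enumerate _)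

module _ {n : ℕ} (G : Graph n) where
  open Graph G

  -- `symmetric` relates opposite orientations only, so the two proofs are compared through the
  -- reversed edge.
  colour-irrelevant : ∀ {k} (κ : EdgeColouring G k) {u v} (p q : u ~ v) →
                      EdgeColouring.colour κ p ≡ EdgeColouring.colour κ q
  colour-irrelevant κ p q = trans (symmetric p (~-sym p)) (sym (symmetric q (~-sym p)))
    where open EdgeColouring κ

  -- This reduces Class 1, for a cubic graph with a vertex, to the existence of a 3-edge-colouring.
  cubic-colours≥3 : Cubic G → Fin n → ∀ k → EdgeColouring G k → 3 ≤ k
  cubic-colours≥3 cubic v k κ = injective⇒≤ {f = λ c → colour (adjacent c)} inj
    where
    open EdgeColouring κ
    open Enumeration (neighbour-enumeration G cubic v)
    adjacent : ∀ c → v ~ elem c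
    adjacent c = does⇒ (v ~? elem c) (sound c)
    inj : Injective _≡_ _≡_ (λ c → colour (adjacent c))
    inj {c} {d} eq with c ≟ d
    ... | yes c≡d = c≡d
    ... | no  c≢d = contradiction eq (proper (adjacent c) (adjacent d) (c≢d ∘ injective))

  -- Properness is kept apart from the colouring, since it is to be deduced at one vertex from its
  -- validity at all the others.
  module _ (cubic : Cubic G) (colour : ∀ {u v} → u ~ v → Fin 3)
           (symmetric : ∀ {u v} (p : u ~ v) (q : v ~ u) → colour p ≡ colour q) where

    ProperAt : Fin n → Set
    ProperAt u = ∀ {v w} (p : u ~ v) (q : u ~ w) → v ≢ w → colour p ≢ colour q

    module _ (v : Fin n) where
      open Enumeration (neighbour-enumeration G cubic v)

      private
        adjacent : ∀ c → v ~ elem c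
        adjacent c = does⇒ (v ~? elem c) (sound c)

      every-colour-at : ProperAt v → ∀ c → ∃[ u ] Σ[ p ∈ v ~ u ] colour p ≡ c
      every-colour-at proper c = let d , eq = injective⇒surjective inj c in elem d , adjacent d , eq
        where
        inj : Injective _≡_ _≡_ (λ d → colour (adjacent d))
        inj {d} {e} eq with d ≟ e
        ... | yes d≡e = d≡e
        ... | no  d≢e = contradiction eq (proper (adjacent d) (adjacent e) (d≢e ∘ injective))

      -- Choosing an edge for each colour injects the three colours into the three neighbours. The
      -- choice is therefore onto, every neighbour is the one chosen for the colour of its edge, and
      -- equal colours mean equal neighbours.
      every-colour⇒proper : (∀ c → ∃[ u ] Σ[ p ∈ v ~ u ] colour p ≡ c) → ProperAt v
      every-colour⇒proper every p q x≢y pq =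
        x≢y (trans (sym (slot-of p)) (trans (cong (elem ∘ proj₁ ∘ slot) pq) (slot-of q)))
        where
        irrelevant : ∀ {u} (p q : v ~ u) → colour p ≡ colour q
        irrelevant p q = trans (symmetric p (~-sym p)) (sym (symmetric q (~-sym p)))
        slot : ∀ c → ∃[ d ] colour (adjacent d) ≡ c
        slot c with u , p , eq ← every c with d , refl ← complete u (dec-true (v ~? u) p) = d , trans (irrelevant _ p) eq
        slot-inj : Injective _≡_ _≡_ (proj₁ ∘ slot)
        slot-inj {c} {d} eq = trans (sym (proj₂ (slot c))) (trans (cong (colour ∘ adjacent) eq) (proj₂ (slot d)))
        slot-of : ∀ {u} (p : v ~ u) → elem (proj₁ (slot (colour p))) ≡ u
        slot-of {u} p with d , refl ← complete u (dec-true (v ~? u) p) with c , refl ← injective⇒surjective slot-inj d =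
          cong (elem ∘ proj₁ ∘ slot) (trans (irrelevant p _) (proj₂ (slot c)))

    -- Each colour class has degree 1 off a, so n − 1 + (its degree at a) is even, as is n
    -- because 3 n is; hence every colour occurs at a.
    proper-off⇒proper-at : ∀ a → (∀ v → v ≢ a → ProperAt v) → ProperAt a
    proper-off⇒proper-at a proper-off = every-colour⇒proper a every
      where
      coloured? : ∀ c v u → Dec (Σ[ p ∈ v ~ u ] colour p ≡ c)
      coloured? c v u with v ~? u
      ... | no ¬p = no (¬p ∘ proj₁)
      ... | yes p = map′ (p ,_) (λ (q , eq) → trans (trans (symmetric p (~-sym p)) (sym (symmetric q (~-sym p)))) eq) (colour p ≟ c)
      M : Fin 3 → Fin n → Fin n → ℕ
      M c v u = χ (does (coloured? c v u))
      flip : ∀ {c v u} → Σ[ p ∈ v ~ u ] colour p ≡ c → Σ[ p ∈ u ~ v ] colour p ≡ c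
      flip (p , eq) = ~-sym p , trans (sym (symmetric p (~-sym p))) eq
      M-even : ∀ c → 2 ∣ sum (λ v → sum (M c v))
      M-even c = symmetric-sum-even (M c)
        (λ v u → cong χ (does-⇔ (mk⇔ flip flip) (coloured? c v u) (coloured? c u v)))
        (λ v → cong χ (dec-false (coloured? c v v) (~-irr ∘ proj₁)))
      3n-even : 2 ∣ n * 3
      3n-even = subst (2 ∣_) (trans (sum-cong-≗ (λ v → trans (sym (degree-sum G v)) (cubic v))) (sum-const n 3))
        (symmetric-sum-even (λ v u → χ (does (v ~? u)))
          (λ v u → cong χ (does-⇔ (mk⇔ ~-sym ~-sym) (v ~? u) (u ~? v)))
          (λ v → cong χ (dec-false (v ~? v) ~-irr)))
      row : ∀ c v → v ≢ a → sum (M c v) ≡ 1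
      row c v v≢a with u , p , eq ← every-colour-at v (proper-off v v≢a) c = enumeration-size record
        { elem = λ _ → u ; injective = λ { {zero} {zero} _ → refl } ; sound = λ _ → dec-true (coloured? c v u) (p , eq)
        ; complete = λ w t → zero , unique (does⇒ (coloured? c v w) t) }
        where
        unique : ∀ {w} → Σ[ q ∈ v ~ w ] colour q ≡ c → u ≡ w
        unique {w} (q , eq′) with u ≟ w
        ... | yes u≡w = u≡w
        ... | no  u≢w = contradiction (trans eq (sym eq′)) (proper-off v v≢a p q u≢w)
      total : ∀ c → suc (sum (λ v → sum (M c v))) ≡ n + sum (M c a)
      total c = sum-ones-off (λ v → sum (M c v)) a (row c)
      n-even : 2 ∣ n
      n-even = ∣m+n∣m⇒∣n {m = n * 2} (subst (2 ∣_) (trans (*-suc n 2) (+-comm n (n * 2))) 3n-even) (divides n refl)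
      every : ∀ c → ∃[ u ] Σ[ p ∈ a ~ u ] colour p ≡ c
      every c with any? (coloured? c a)
      ... | yes found = found
      ... | no missed = contradiction (∣⇒≤ 2∣1) λ { (s≤s ()) }
        where
        row≡0 : sum (M c a) ≡ 0
        row≡0 = sum-zero (λ u → cong χ (dec-false (coloured? c a u) (λ s → missed (u , s))))
        s = sum (λ v → sum (M c v))
        2∣1 : 2 ∣ 1
        2∣1 = ∣m+n∣m⇒∣n {m = s}
          (subst (2 ∣_) (trans (sym (+-identityʳ n)) (trans (cong (n +_) (sym row≡0)) (trans (sym (total c)) (+-comm 1 s)))) n-even) (M-even c)

-- Edge colourings of the composite

quotient-combine : ∀ {n k} (u : Fin n) (i : Fin k) → quotient k (combine u i) ≡ u
quotient-combine u i = cong proj₁ (remQuot-combine u i)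

remainder-combine : ∀ {n k} (u : Fin n) (i : Fin k) → remainder {n} k (combine u i) ≡ i
remainder-combine u i = cong proj₂ (remQuot-combine u i)

remQuot-injective : ∀ {n k} (x y : Fin (n * k)) → quotient {n} k x ≡ quotient {n} k y →
                    remainder {n} k x ≡ remainder {n} k y → x ≡ y
remQuot-injective {n} {k} x y q r = trans (sym (combine-remQuot {n} k x)) (trans (cong₂ combine q r) (combine-remQuot {n} k y))

module _ {k : ℕ} (A : Graph (suc k)) (cubic : Cubic A) (a : Fin (suc k)) where
  open Graph A
  private
    module B = Graph (A ∖ a)

  degree-∖ : ∀ i → B.degree i + χ (does (punchIn a i ~? a)) ≡ 3
  degree-∖ i = begin
    B.degree i + χ (does (x ~? a))                                     ≡⟨ cong (_+ χ (does (x ~? a))) (degree-sum (A ∖ a) i) ⟩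
    sum (λ j → χ (does (x ~? punchIn a j))) + χ (does (x ~? a))        ≡⟨ +-comm _ (χ (does (x ~? a))) ⟩
    χ (does (x ~? a)) + sum (λ j → χ (does (x ~? punchIn a j)))        ≡⟨ sym (sum-remove {i = a} (λ y → χ (does (x ~? y)))) ⟩
    sum (λ y → χ (does (x ~? y)))                                      ≡⟨ sym (degree-sum A x) ⟩
    degree x                                                           ≡⟨ cubic x ⟩
    3                                                                  ∎
    where
    open ≡-Reasoning
    x = punchIn a i

  adjacent⇒degree2 : ∀ {i} → punchIn a i ~ a → B.degree i ≡ 2
  adjacent⇒degree2 {i} p = +-cancelʳ-≡ 1 _ _ (trans (cong (λ b → B.degree i + χ b) (sym (dec-true (punchIn a i ~? a) p))) (degree-∖ i))

  degree2⇒adjacent : ∀ {i} → B.degree i ≡ 2 → punchIn a i ~ a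
  degree2⇒adjacent {i} d with punchIn a i ~? a | degree-∖ i
  ... | yes p | _ = p
  ... | no _  | e = contradiction (trans (cong (_+ 0) (sym d)) e) λ ()

  nonadjacent⇒degree3 : ∀ {i} → ¬ punchIn a i ~ a → B.degree i ≡ 3
  nonadjacent⇒degree3 {i} ¬p = trans (sym (+-identityʳ _)) (trans (cong (λ b → B.degree i + χ b) (sym (dec-false (punchIn a i ~? a) ¬p))) (degree-∖ i))

  module _ {n : ℕ} (G : Graph n) (L : Linking G (A ∖ a)) where
    private
      module G = Graph G
      H = compose G (A ∖ a) L
      module H = Graph H
    open Linking L

    at : Fin (n * k) → Fin n
    at = quotient k

    pos : Fin (n * k) → Fin k
    pos = remainder {n} k

    inner : ∀ u {i j} → i B.~ j → combine u i H.~ combine u j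
    inner u {i} {j} p = inj₁ (trans (quotient-combine u i) (sym (quotient-combine u j)) ,
      subst₂ B._~_ (sym (remainder-combine u i)) (sym (remainder-combine u j)) p)

    cross : ∀ {u v i} → u G.~ v → port u v ≡ i → combine u i H.~ combine v (port v u)
    cross {u} {v} {i} e p = inj₂
      ( subst₂ G._~_ (sym (quotient-combine u i)) (sym (quotient-combine v (port v u))) e
      , trans (cong₂ port (quotient-combine u i) (quotient-combine v (port v u))) (trans p (sym (remainder-combine u i)))
      , trans (cong₂ port (quotient-combine v (port v u)) (quotient-combine u i)) (sym (remainder-combine v (port v u))) )

    abstract
      link : ∀ u i → B.degree i ≡ 2 → ∃[ v ] (u G.~ v × port u v ≡ i)
      link u i d = let v , p , _ = port-unique u i d in v , p

    link-unique : ∀ {u v w} → u G.~ v → u G.~ w → port u v ≡ port u w → v ≡ w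
    link-unique {u} {v} {w} p q eq = let _ , _ , uniq = port-unique u (port u v) (port-degree p) in
      trans (sym (uniq (p , refl))) (uniq (q , sym eq))

    -- A vertex keeps its `B.degree i` neighbours inside the copy and receives one added edge
    -- exactly when that degree is 2.
    compose-cubic : Cubic H
    compose-cubic x = begin
      H.degree x                                           ≡⟨ degree-sum H x ⟩
      sum (λ y → χ (does (x H.~? y)))                      ≡⟨ sum-combine n k _ ⟩
      sum (λ v → sum (λ j → χ (does (x H.~? combine {n} {k} v j))))  ≡⟨ sum-cong-≗ row ⟩
      sum (λ v → χ (does (u ≟ v)) * B.degree i + χ (linked v))  ≡⟨ ∑-distrib-+ (λ v → χ (does (u ≟ v)) * B.degree i) (χ ∘ linked) ⟩
      sum (λ v → χ (does (u ≟ v)) * B.degree i) + sum (χ ∘ linked)  ≡⟨ cong (_+ sum (χ ∘ linked)) (sum-single u (λ _ → B.degree i)) ⟩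
      B.degree i + sum (χ ∘ linked)                        ≡⟨ last (punchIn a i ~? a) ⟩
      3                                                    ∎
      where
      open ≡-Reasoning
      u = at x
      i = pos x
      linked : Fin n → Bool
      linked v = does (u G.~? v) ∧ does (port u v ≟ i)
      linked⇒ : ∀ {v} → linked v ≡ true → u G.~ v × port u v ≡ i
      linked⇒ {v} t with u G.~? v | port u v ≟ i
      ... | yes e | yes p = e , p
      ⇒linked : ∀ {v} → u G.~ v → port u v ≡ i → linked v ≡ true
      ⇒linked {v} e p = cong₂ _∧_ (dec-true (u G.~? v) e) (dec-true (port u v ≟ i) p)
      last : Dec (punchIn a i ~ a) → B.degree i + sum (χ ∘ linked) ≡ 3
      last (yes p) with v , e , pv ← link u i (adjacent⇒degree2 p) = cong₂ _+_ (adjacent⇒degree2 p) (enumeration-size record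
        { elem = λ _ → v ; injective = λ { {zero} {zero} _ → refl } ; sound = λ _ → ⇒linked e pv
        ; complete = λ w t → zero , link-unique e (proj₁ (linked⇒ t)) (trans pv (sym (proj₂ (linked⇒ t)))) })
      last (no ¬p) = cong₂ _+_ (nonadjacent⇒degree3 ¬p) (sum-zero λ v → absent v (linked v) refl)
        where
        absent : ∀ v b → linked v ≡ b → χ b ≡ 0
        absent v false _ = refl
        absent v true t with e , pv ← linked⇒ {v} t = contradiction (degree2⇒adjacent (trans (cong B.degree (sym pv)) (port-degree e))) ¬p
      -- The two disjuncts of adjacency exclude each other because `G` has no loops, so the
      -- indicator of the disjunction is the sum of the two indicators.
      split : ∀ v j → χ (does (x H.~? combine v j)) ≡
              χ (does (u ≟ v)) * χ (does (i B.~? j)) + χ (linked v) * χ (does (port v u ≟ j))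
      split v j rewrite quotient-combine v j | remainder-combine {n} v j with u ≟ v
      ... | no  _    = trans (χ-∧ (does (u G.~? v)) _ _) refl
        where
        χ-∧ : ∀ b c d → χ (b ∧ (c ∧ d)) ≡ χ (b ∧ c) * χ d
        χ-∧ true true d = sym (*-identityˡ (χ d))
        χ-∧ true false d = refl
        χ-∧ false c d = refl
      ... | yes refl rewrite dec-false (u G.~? u) G.~-irr with does (i B.~? j)
      ...   | true  = refl
      ...   | false = refl
      row : ∀ v → sum (λ j → χ (does (x H.~? combine v j))) ≡ χ (does (u ≟ v)) * B.degree i + χ (linked v)
      row v = begin
        sum (λ j → χ (does (x H.~? combine v j)))   ≡⟨ sum-cong-≗ (split v) ⟩
        sum (λ j → χ (does (u ≟ v)) * χ (does (i B.~? j)) + χ (linked v) * χ (does (port v u ≟ j)))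
          ≡⟨ ∑-distrib-+ (λ j → χ (does (u ≟ v)) * χ (does (i B.~? j))) _ ⟩
        sum (λ j → χ (does (u ≟ v)) * χ (does (i B.~? j))) + sum (λ j → χ (linked v) * χ (does (port v u ≟ j)))
          ≡⟨ cong₂ _+_ (*-distribˡ-sum (χ (does (u ≟ v))) (λ j → χ (does (i B.~? j)))) (*-distribˡ-sum (χ (linked v)) (λ j → χ (does (port v u ≟ j)))) ⟩
        χ (does (u ≟ v)) * sum (λ j → χ (does (i B.~? j))) + χ (linked v) * sum (λ j → χ (does (port v u ≟ j)))
          ≡⟨ cong₂ (λ s t → χ (does (u ≟ v)) * s + χ (linked v) * t) (sym (degree-sum (A ∖ a) i)) (sum-δ (port v u)) ⟩
        χ (does (u ≟ v)) * B.degree i + χ (linked v) * 1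
          ≡⟨ cong (χ (does (u ≟ v)) * B.degree i +_) (*-identityʳ _) ⟩
        χ (does (u ≟ v)) * B.degree i + χ (linked v) ∎

    module FromComposite (κ : EdgeColouring H 3) where
      private
        module κ = EdgeColouring κ

      innerColour : ∀ u {i j} → i B.~ j → Fin 3
      innerColour u {i} {j} p = κ.colour {combine u i} {combine u j} (inner u p)

      crossColour : ∀ {u v i} → u G.~ v → port u v ≡ i → Fin 3
      crossColour {u} {v} {i} e p = κ.colour {combine u i} {combine v (port v u)} (cross e p)

      linkColour : ∀ u i → B.degree i ≡ 2 → Fin 3
      linkColour u i d = let _ , e , p = link u i d in crossColour e p

      linkColour-cross : ∀ {u v i} (d : B.degree i ≡ 2) (e : u G.~ v) → port u v ≡ i → linkColour u i d ≡ crossColour e refl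
      linkColour-cross {u} {v} {i} d e refl with w , e′ , p ← link u (port u v) d with refl ← link-unique e′ e p with refl ← p =
        colour-irrelevant H κ {combine u i} {combine v (port v u)} (cross e′ refl) (cross e refl)

      linkColour-irrelevant : ∀ u i d d′ → linkColour u i d ≡ linkColour u i d′
      linkColour-irrelevant u i d d′ = cong (linkColour u i) (≡-irrelevant d d′)

      data View : Fin (suc k) → Set where
        root  : View a
        other : ∀ i → View (punchIn a i)

      view : ∀ x → View x
      view x with a ≟ x
      ... | yes refl = root
      ... | no a≢x = subst View (punchIn-punchOut a≢x) (other (punchOut a≢x))

      -- An edge at `a` takes the colour of the edge added at its other end, as if everything
      -- outside the copy were contracted to `a`. The views are arguments so that later proofs can
      -- match on them.
      colour′ : ∀ (u : Fin n) {x y} → View x → View y → x ~ y → Fin 3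
      colour′ u root      root      p = contradiction p ~-irr
      colour′ u root      (other i) p = linkColour u i (adjacent⇒degree2 (~-sym p))
      colour′ u (other i) root      p = linkColour u i (adjacent⇒degree2 p)
      colour′ u (other i) (other j) p = innerColour u p

      colour-copy : ∀ u {x y} → x ~ y → Fin 3
      colour-copy u {x} {y} = colour′ u (view x) (view y)

      symmetric-copy : ∀ u {x y} (p : x ~ y) (q : y ~ x) → colour-copy u p ≡ colour-copy u q
      symmetric-copy u {x} {y} p q with view x | view y
      ... | root    | root    = contradiction p ~-irr
      ... | root    | other i = linkColour-irrelevant u i _ _
      ... | other i | root    = linkColour-irrelevant u i _ _
      ... | other i | other j = κ.symmetric {combine u i} {combine u j} (inner u p) (inner u q)

      -- Away from `a`, edges of `A` stand for edges of the composite at one vertex. An inner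
      -- neighbour and a linked one are distinct since they lie in different copies.
      proper-off-root : ∀ u x → x ≢ a → ProperAt A cubic (colour-copy u) (symmetric-copy u) x
      proper-off-root u x x≢a {y} {z} p q y≢z with view x | view y | view z
      ... | root    | _       | _       = contradiction refl x≢a
      ... | other i | root    | root    = contradiction refl y≢z
      ... | other i | other j | other l = κ.proper {combine u i} {combine u j} {combine u l} (inner u p) (inner u q)
        (λ eq → y≢z (cong (punchIn a) (combine-injectiveʳ u j u l eq)))
      ... | other i | root    | other l with v , e , pv ← link u i (adjacent⇒degree2 p) =
        κ.proper {combine u i} {combine v (port v u)} {combine u l} (cross e pv) (inner u q) (λ eq → G.~-irr (subst (u G.~_) (combine-injectiveˡ v (port v u) u l eq) e))
      proper-off-root u x x≢a {y} {z} p q y≢z | other i | other j | root with v , e , pv ← link u i (adjacent⇒degree2 q) =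
        κ.proper {combine u i} {combine u j} {combine v (port v u)} (inner u p) (cross e pv) (λ eq → G.~-irr (subst (u G.~_) (sym (combine-injectiveˡ u j v (port v u) eq)) e))

      proper-copy : ∀ u x → ProperAt A cubic (colour-copy u) (symmetric-copy u) x
      proper-copy u x with x ≟ a
      ... | yes refl = proper-off⇒proper-at A cubic (colour-copy u) (symmetric-copy u) a (proper-off-root u)
      ... | no x≢a   = proper-off-root u x x≢a

      colour-copy-root : ∀ u {x} i (p : a ~ x) → x ≡ punchIn a i → (d : B.degree i ≡ 2) → colour-copy u p ≡ linkColour u i d
      colour-copy-root u {x} i p eq d = go (view a) (view x) p refl eq
        where
        go : ∀ {y x} (s : View y) (t : View x) (p : y ~ x) → y ≡ a → x ≡ punchIn a i → colour′ u s t p ≡ linkColour u i d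
        go root root p _ eq = contradiction (sym eq) (punchInᵢ≢i a i)
        go root (other j) p _ eq with refl ← punchIn-injective a j i eq = linkColour-irrelevant u j _ d
        go (other j) _ p eq _ = contradiction eq (punchInᵢ≢i a j)

      colouring-A : Fin n → EdgeColouring A 3
      colouring-A u = record { colour = colour-copy u ; symmetric = symmetric-copy u ; proper = λ {x} → proper-copy u x }

      -- The edges of `G` at `u` correspond under `to` to edges of `A` at `a`, with the same colours
      -- in the copy at `u`. Properness at `u` is thus the parity result at `a`.
      colouring-G : EdgeColouring G 3
      colouring-G = record
        { colour    = λ e → crossColour e refl
        ; symmetric = λ {u} {v} e e′ → κ.symmetric {combine u (port u v)} {combine v (port v u)} (cross e refl) (cross e′ refl)
        ; proper    = λ {u} {v} {w} e f v≢w eq → proper-copy u a (to e) (to f)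
            (λ eq′ → v≢w (link-unique e f (punchIn-injective a _ _ eq′)))
            (trans (to-colour e) (trans eq (sym (to-colour f)))) }
        where
        to : ∀ {u v} → u G.~ v → a ~ punchIn a (port u v)
        to e = ~-sym (degree2⇒adjacent (port-degree e))
        to-colour : ∀ {u v} (e : u G.~ v) → colour-copy u (to e) ≡ crossColour e refl
        to-colour {u} {v} e = trans (colour-copy-root u (port u v) (to e) refl (port-degree e)) (linkColour-cross (port-degree e) e refl)

    module ToComposite (γ : EdgeColouring G 3) (α : EdgeColouring A 3) where
      private
        module γ = EdgeColouring γ
        module α = EdgeColouring α

      linkColour : ∀ u {i} → punchIn a i ~ a → Fin 3
      linkColour u {i} p = γ.colour (proj₁ (proj₂ (link u i (adjacent⇒degree2 p))))

      linkColour-port : ∀ {u v} (e : u G.~ v) (p : punchIn a (port u v) ~ a) → linkColour u p ≡ γ.colour e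
      linkColour-port {u} {v} e p with w , e′ , eq ← link u (port u v) (adjacent⇒degree2 p) with refl ← link-unique e′ e eq =
        colour-irrelevant G γ e′ e

      linkColour-injective : ∀ u {i j} (p : punchIn a i ~ a) (q : punchIn a j ~ a) → linkColour u p ≡ linkColour u q → i ≡ j
      linkColour-injective u {i} {j} p q eq
        with v , e , pv ← link u i (adjacent⇒degree2 p) | w , f , pw ← link u j (adjacent⇒degree2 q) with v ≟ w
      ... | yes refl = trans (sym pv) pw
      ... | no  v≢w  = contradiction eq (γ.proper e f v≢w)

      abstract
        at-root : ∀ c → Σ[ i ∈ Fin k ] Σ[ p ∈ punchIn a i ~ a ] α.colour p ≡ c
        at-root c with every-colour-at A cubic α.colour α.symmetric a α.proper c
        ... | x , p , eq with a ≟ x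
        ...   | yes refl = contradiction p ~-irr
        ...   | no a≢x with y ← punchOut a≢x | refl ← punchIn-punchOut a≢x = y , ~-sym p , trans (α.symmetric _ p) eq

      -- The permutation of colours, in the copy at `u`, that turns the colour of each edge of `A`
      -- at `a` into the colour of the edge of `G` attached at its other end.
      recolour : Fin n → Fin 3 → Fin 3
      recolour u c = linkColour u (proj₁ (proj₂ (at-root c)))

      recolour-injective : ∀ u {c d} → recolour u c ≡ recolour u d → c ≡ d
      recolour-injective u {c} {d} eq with at-root c | at-root d
      ... | i , p , refl | j , q , refl with refl ← linkColour-injective u p q eq = colour-irrelevant A α p q

      recolour-link : ∀ u {i} (p : punchIn a i ~ a) → recolour u (α.colour p) ≡ linkColour u p
      recolour-link u {i} p with at-root (α.colour p)
      ... | j , q , eq with i ≟ j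
      ...   | yes refl = cong (λ d → γ.colour (proj₁ (proj₂ (link u i d)))) (≡-irrelevant _ _)
      ...   | no i≢j = contradiction (trans (α.symmetric _ q) (trans eq (α.symmetric p (~-sym p))))
                         (α.proper (~-sym q) (~-sym p) (i≢j ∘ sym ∘ punchIn-injective a _ _))

      colour : ∀ {x y} → x H.~ y → Fin 3
      colour {x} (inj₁ (_ , p)) = recolour (at x) (α.colour p)
      colour     (inj₂ (e , _)) = γ.colour e

      port-adjacent : ∀ {u v i} → u G.~ v → port u v ≡ i → punchIn a i ~ a
      port-adjacent e refl = degree2⇒adjacent (port-degree e)

      -- The added edge carries the recoloured colour of the edge of `A` from its port to `a`, so
      -- the claim is properness of the colouring of `A` at that port.
      inner≢cross : ∀ {u v i j} (p : punchIn a i ~ punchIn a j) (e : u G.~ v) → port u v ≡ i →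
                    recolour u (α.colour p) ≢ γ.colour e
      inner≢cross {u} {v} {i} {j} p e refl eq = α.proper p r (punchInᵢ≢i a j)
        (recolour-injective u (trans eq (trans (sym (linkColour-port e r)) (sym (recolour-link u r)))))
        where
        r = port-adjacent e refl

      colouring : EdgeColouring H 3
      colouring = record { colour = λ {x} {y} → colour {x} {y} ; symmetric = λ {x} {y} → symmetric {x} {y} ; proper = λ {x} {y} {z} → proper {x} {y} {z} }
        where
        symmetric : ∀ {x y} (p : x H.~ y) (q : y H.~ x) → colour {x} {y} p ≡ colour {y} {x} q
        symmetric (inj₁ (e , p)) (inj₁ (_ , q)) = cong₂ recolour e (α.symmetric p q)
        symmetric {x} {y} (inj₁ (e , _)) (inj₂ (f , _)) = contradiction (subst (at y G.~_) e f) G.~-irr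
        symmetric {x} {y} (inj₂ (e , _)) (inj₁ (f , _)) = contradiction (subst (at x G.~_) f e) G.~-irr
        symmetric (inj₂ (e , _)) (inj₂ (f , _)) = γ.symmetric e f
        proper : ∀ {x y z} (p : x H.~ y) (q : x H.~ z) → y ≢ z → colour {x} {y} p ≢ colour {x} {z} q
        proper {x} {y} {z} (inj₁ (e , p)) (inj₁ (f , q)) y≢z eq = α.proper p q
          (λ eq′ → y≢z (remQuot-injective y z (trans (sym e) f) (punchIn-injective a _ _ eq′))) (recolour-injective (at x) eq)
        proper (inj₁ (_ , p)) (inj₂ (f , pf , _)) _ eq = inner≢cross p f pf eq
        proper (inj₂ (e , pe , _)) (inj₁ (_ , q)) _ eq = inner≢cross q e pe (sym eq)
        proper {x} {y} {z} (inj₂ (e , _ , pe)) (inj₂ (f , _ , pf)) y≢z eq with at y ≟ at z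
        ... | yes same = y≢z (remQuot-injective y z same (trans (sym pe) (trans (cong (λ v → port v (at x)) same) pf)))
        ... | no  diff = γ.proper e f diff eq

    class1⇔ : Cubic G → Class1 H ⇔ (Class1 G × Class1 A)
    class1⇔ cubic-G = mk⇔ to from
      where
      3≰0 : ¬ 3 ≤ 0
      3≰0 ()
      -- The bound by three colours needs a vertex. Class 1 supplies one: the empty graph is
      -- coloured with 0 colours, against the minimality of 3.
      vertex : ∀ {m} (X : Graph m) → Class1 X → Fin m
      vertex {zero}  X (_ , least) = contradiction (least 0 record { colour = λ { {()} } ; symmetric = λ { {()} } ; proper = λ { {()} } }) 3≰0
      vertex {suc m} X _ = zero
      to : Class1 H → Class1 G × Class1 A
      to class1@(κ , _) = let u = at (vertex H class1) in
        (colouring-G , cubic-colours≥3 G cubic-G u) , (colouring-A u , cubic-colours≥3 A cubic a)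
        where open FromComposite κ
      from : Class1 G × Class1 A → Class1 H
      from (class1@(γ , _) , (α , _)) = colouring , cubic-colours≥3 H compose-cubic (combine (vertex G class1) (proj₁ (at-root zero)))
        where open ToComposite γ α

-- Conversion sets and forests

strict-or-equal : ∀ {n} {p q : Subset n} → p ⊆ q → q ≡ p ⊎ ∣ p ∣ < ∣ q ∣
strict-or-equal {p = p} {q} p⊆q with any? (λ x → (x ∈? q) ×-dec ¬? (x ∈? p))
... | yes (x , x∈q , x∉p) = inj₂ (p⊂q⇒∣p∣<∣q∣ (p⊆q , x , x∈q , x∉p))
... | no same = inj₁ (⊆-antisym (λ {x} x∈q → decidable-stable (x ∈? p) λ x∉p → same (x , x∈q , x∉p)) p⊆q)

-- Until a fixed point is reached every step adds an element, so `n` steps suffice. This serves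
-- twice: it makes conversion sets decidable, and it makes a growing ball exhaust an orbit.
module Stabilisation {n : ℕ} (F : Subset n → Subset n) (inflationary : ∀ S → S ⊆ F S)
                     (P : ℕ → Subset n) (P-suc : ∀ t → P (suc t) ≡ F (P t)) where

  fixed-or-large : ∀ t → F (P t) ≡ P t ⊎ t ≤ ∣ P t ∣
  fixed-or-large zero = inj₂ z≤n
  fixed-or-large (suc t) with fixed-or-large t
  ... | inj₁ fixed = inj₁ (trans (cong F (trans (P-suc t) fixed)) (trans fixed (sym (trans (P-suc t) fixed))))
  ... | inj₂ t≤ with strict-or-equal (inflationary (P t))
  ...   | inj₁ fixed = inj₁ (trans (cong F (trans (P-suc t) fixed)) (trans fixed (sym (trans (P-suc t) fixed))))
  ...   | inj₂ grows = inj₂ (≤-trans (s≤s t≤) (subst (λ S → ∣ P t ∣ < ∣ S ∣) (sym (P-suc t)) grows))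

  stable : F (P n) ≡ P n
  stable with fixed-or-large n
  ... | inj₁ fixed = fixed
  ... | inj₂ n≤ with full ← ∣p∣≡n⇒p≡⊤ {p = P n} (≤-antisym (∣p∣≤n (P n)) n≤) =
    ⊆-antisym (subst (F (P n) ⊆_) (sym full) (⊆-max _)) (inflationary (P n))

  increasing : ∀ t d → P t ⊆ P (t + d)
  increasing t zero    = ⊆-reflexive (cong P (sym (+-identityʳ t)))
  increasing t (suc d) = ⊆-trans (increasing t d)
    (subst (P (t + d) ⊆_) (trans (sym (P-suc (t + d))) (cong P (sym (+-suc t d)))) (inflationary (P (t + d))))

  constant : ∀ d → P (n + d) ≡ P n
  constant zero    = cong P (+-identityʳ n)
  constant (suc d) = trans (cong P (+-suc n d)) (trans (P-suc (n + d)) (trans (cong F (constant d)) stable))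

  bounded : ∀ t → P t ⊆ P n
  bounded t with ≤-total t n
  ... | inj₁ t≤n with d , refl ← m≤n⇒∃[o]m+o≡n t≤n = increasing t d
  ... | inj₂ n≤t with d , refl ← m≤n⇒∃[o]m+o≡n n≤t = ⊆-reflexive (constant d)

least : ∀ {P : ℕ → Set} → Decidable P → ∀ n → P n → ∃ (IsLeast P)
least P? n p with P? 0
... | yes p₀ = 0 , p₀ , λ _ _ → z≤n
least P? zero    p | no ¬p₀ = contradiction p ¬p₀
least P? (suc n) p | no ¬p₀ with c , pc , minimal ← least (P? ∘ suc) n p =
  suc c , pc , λ { zero p₀ → contradiction p₀ ¬p₀ ; (suc j) pj → s≤s (minimal j pj) }

-- The whole vertex set bounds the search, and conversion is decided by looking at stage `n` alone.
c₂-exists : ∀ {n} (G : Graph n) → ∃ (IsC₂ G)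
c₂-exists {n} G = least (λ c → anySubset? (λ S → conversion? S ×-dec (∣ S ∣ ≟ℕ c))) ∣ ⊤ {n} ∣ (⊤ , (0 , refl) , refl)
  where
  conversion? : Decidable (ConversionSet G)
  conversion? S = map′ (n ,_) (λ (t , full) → ⊆-antisym (⊆-max _) (subst (_⊆ process G S n) full (bounded t))) (≡-dec Bool._≟_ (process G S n) ⊤)
    where open Stabilisation (step G) (λ S → p⊆p∪q _) (process G S) (λ _ → refl)

module Forest {k : ℕ} (e : Fin k → Fin k → ℕ) (e-sym : ∀ i j → e i j ≡ e j i) (e-diag : ∀ i → e i i ≡ 0) where

  degreeIn : (Fin k → Bool) → Fin k → ℕ
  degreeIn U i = sum (λ j → χ (U j) * e i j)

  -- Every edge inside `U` is counted from both ends; doubling avoids orienting the edges.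
  edges² : (Fin k → Bool) → ℕ
  edges² U = sum (λ i → χ (U i) * degreeIn U i)

  remove : (Fin k → Bool) → Fin k → Fin k → Bool
  remove U w i = U i ∧ not (does (w ≟ i))

  remove⊆ : ∀ U w {i} → remove U w i ≡ true → U i ≡ true
  remove⊆ U w {i} t with U i
  ... | true = refl

  χ-remove : ∀ U {w} → U w ≡ true → ∀ i → χ (U i) ≡ χ (remove U w i) + χ (does (w ≟ i))
  χ-remove U {w} Uw i with w ≟ i
  ... | yes refl = trans (cong χ Uw) (cong (λ b → χ (b ∧ false) + 1) (sym Uw))
  ... | no _ with U i
  ...   | true  = refl
  ...   | false = refl

  sum-remove′ : ∀ U {w} → U w ≡ true → (f : Fin k → ℕ) → sum (λ i → χ (U i) * f i) ≡ sum (λ i → χ (remove U w i) * f i) + f w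
  sum-remove′ U {w} Uw f = begin
    sum (λ i → χ (U i) * f i)
      ≡⟨ sum-cong-≗ (λ i → trans (cong (_* f i) (χ-remove U Uw i)) (*-distribʳ-+ (f i) (χ (remove U w i)) (χ (does (w ≟ i))))) ⟩
    sum (λ i → χ (remove U w i) * f i + χ (does (w ≟ i)) * f i)
      ≡⟨ ∑-distrib-+ (λ i → χ (remove U w i) * f i) (λ i → χ (does (w ≟ i)) * f i) ⟩
    sum (λ i → χ (remove U w i) * f i) + sum (λ i → χ (does (w ≟ i)) * f i)
      ≡⟨ cong (sum (λ i → χ (remove U w i) * f i) +_) (sum-single w f) ⟩
    sum (λ i → χ (remove U w i) * f i) + f w ∎
    where open ≡-Reasoning

  count-remove : ∀ U {w m} → U w ≡ true → sum (χ ∘ U) ≡ suc m → sum (χ ∘ remove U w) ≡ m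
  count-remove U {w} {m} Uw eq = suc-injective (begin
    suc (sum (χ ∘ remove U w))                       ≡⟨ +-comm 1 _ ⟩
    sum (χ ∘ remove U w) + 1                         ≡⟨ cong (_+ 1) (sum-cong-≗ (λ i → sym (*-identityʳ (χ (remove U w i))))) ⟩
    sum (λ i → χ (remove U w i) * 1) + 1             ≡⟨ sym (sum-remove′ U Uw (λ _ → 1)) ⟩
    sum (λ i → χ (U i) * 1)                          ≡⟨ sum-cong-≗ (λ i → *-identityʳ (χ (U i))) ⟩
    sum (χ ∘ U)                                      ≡⟨ eq ⟩
    suc m                                            ∎)
    where open ≡-Reasoning

  edges²-remove : ∀ U {w} → U w ≡ true → edges² U ≡ edges² (remove U w) + 2 * degreeIn (remove U w) w
  edges²-remove U {w} Uw = begin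
    edges² U
      ≡⟨ sum-remove′ U Uw (degreeIn U) ⟩
    sum (λ i → χ (U′ i) * degreeIn U i) + degreeIn U w
      ≡⟨ cong₂ _+_ (sum-cong-≗ (λ i → trans (cong (χ (U′ i) *_) (sum-remove′ U Uw (e i))) (*-distribˡ-+ (χ (U′ i)) _ (e i w))))
                   (trans (sum-remove′ U Uw (e w)) (trans (cong (d +_) (e-diag w)) (+-identityʳ d))) ⟩
    sum (λ i → χ (U′ i) * degreeIn U′ i + χ (U′ i) * e i w) + d
      ≡⟨ cong (_+ d) (∑-distrib-+ (λ i → χ (U′ i) * degreeIn U′ i) (λ i → χ (U′ i) * e i w)) ⟩
    edges² U′ + sum (λ i → χ (U′ i) * e i w) + d
      ≡⟨ cong (λ x → edges² U′ + x + d) (sum-cong-≗ (λ i → cong (χ (U′ i) *_) (e-sym i w))) ⟩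
    edges² U′ + d + d
      ≡⟨ +-assoc (edges² U′) d d ⟩
    edges² U′ + (d + d)
      ≡⟨ cong (λ x → edges² U′ + (d + x)) (sym (+-identityʳ d)) ⟩
    edges² U′ + 2 * d ∎
    where
    open ≡-Reasoning
    U′ = remove U w
    d = degreeIn U′ w

  -- Acyclicity of the graph induced on `U`, expressed as 1-degeneracy. This needs no notion of
  -- cycle and is exactly what peeling off vertices uses.
  Degenerate : (Fin k → Bool) → Set
  Degenerate U = ∀ W → (∀ {i} → W i ≡ true → U i ≡ true) → ∃[ i ] W i ≡ true → ∃[ w ] (W w ≡ true × degreeIn W w ≤ 1)

  member : ∀ U {m} → sum {k} (χ ∘ U) ≡ suc m → ∃[ i ] U i ≡ true
  member U eq with any? (λ i → U i Bool.≟ true)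
  ... | yes found = found
  ... | no none = contradiction (trans (sym eq) (sum-zero empty)) λ ()
    where
    empty : ∀ i → χ (U i) ≡ 0
    empty i with U i in Ui
    ... | true  = contradiction (i , Ui) none
    ... | false = refl

  degreeIn-mono : ∀ {U V} → (∀ {i} → U i ≡ true → V i ≡ true) → ∀ i → degreeIn U i ≤ degreeIn V i
  degreeIn-mono {U} {V} U⊆V i = sum-mono λ j → *-monoˡ-≤ (e i j) (χ-mono j)
    where
    χ-mono : ∀ j → χ (U j) ≤ χ (V j)
    χ-mono j with U j in Uj
    ... | true rewrite U⊆V Uj = ≤-refl
    ... | false = z≤n

  -- A forest on `m + 1` vertices has at most `m` edges: remove a vertex of degree at most 1 and use
  -- induction.
  forest-bound : ∀ m U → sum (χ ∘ U) ≡ suc m → Degenerate U → edges² U ≤ 2 * m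
  forest-bound zero U count degenerate with w , Uw ← member U count = ≤-reflexive (begin
    edges² U                                           ≡⟨ edges²-remove U Uw ⟩
    edges² (remove U w) + 2 * degreeIn (remove U w) w  ≡⟨ cong₂ (λ x y → x + 2 * y) (vanish (degreeIn (remove U w))) (vanish (e w)) ⟩
    0                                                  ∎)
    where
    open ≡-Reasoning
    vanish : ∀ f → sum (λ i → χ (remove U w i) * f i) ≡ 0
    vanish f = sum-zero λ i → cong (_* f i) (n≤0⇒n≡0 (subst (χ (remove U w i) ≤_) (count-remove U Uw count) (term≤sum (χ ∘ remove U w) i)))
  forest-bound (suc m) U count degenerate with w , Uw , d≤1 ← degenerate U id (member U count) = begin
    edges² U                                              ≡⟨ edges²-remove U Uw ⟩
    edges² (remove U w) + 2 * degreeIn (remove U w) w     ≤⟨ +-mono-≤ (forest-bound m (remove U w) (count-remove U Uw count) (λ W W⊆ → degenerate W (remove⊆ U w ∘ W⊆)))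
                                                             (*-monoʳ-≤ 2 (≤-trans (degreeIn-mono (remove⊆ U w) w) d≤1)) ⟩
    2 * m + 2                                             ≡⟨ +-comm (2 * m) 2 ⟩
    2 + 2 * m                                             ≡⟨ sym (*-suc 2 m) ⟩
    2 * suc m                                             ∎
    where open ≤-Reasoning

  -- A pair not inside `U` is charged by `out` to an end outside `U`. Each outside vertex is charged
  -- at most `d` times as first end and `d` times as second end.
  total-bound : ∀ d U → (∀ i → sum (e i) ≤ d) → sum (λ i → sum (e i)) ≤ edges² U + 2 * (d * sum (χ ∘ not ∘ U))
  total-bound d U degree≤d = begin
    sum (λ i → sum (e i))
      ≤⟨ sum-mono (λ i → sum-mono (pointwise i)) ⟩
    sum (λ i → sum (λ j → χ (U i) * (χ (U j) * e i j) + (out i j + out j i)))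
      ≡⟨ sum-cong-≗ (λ i → trans (∑-distrib-+ (λ j → χ (U i) * (χ (U j) * e i j)) (λ j → out i j + out j i))
           (cong₂ _+_ (*-distribˡ-sum (χ (U i)) (λ j → χ (U j) * e i j)) (∑-distrib-+ (out i) (λ j → out j i)))) ⟩
    sum (λ i → χ (U i) * degreeIn U i + (sum (out i) + sum (λ j → out j i)))
      ≡⟨ trans (∑-distrib-+ (λ i → χ (U i) * degreeIn U i) _) (cong (edges² U +_) (∑-distrib-+ (λ i → sum (out i)) (λ i → sum (λ j → out j i)))) ⟩
    edges² U + (s + sum (λ i → sum (λ j → out j i)))
      ≡⟨ cong (λ x → edges² U + (s + x)) (trans (∑-comm (λ i j → out j i)) (sym (+-identityʳ s))) ⟩
    edges² U + 2 * s
      ≤⟨ +-monoʳ-≤ (edges² U) (*-monoʳ-≤ 2 s≤) ⟩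
    edges² U + 2 * (d * sum (χ ∘ not ∘ U)) ∎
    where
    open ≤-Reasoning
    out : Fin k → Fin k → ℕ
    out i j = χ (not (U i)) * e i j
    s = sum (λ i → sum (out i))
    s≤ : s ≤ d * sum (χ ∘ not ∘ U)
    s≤ = ≤-trans (sum-mono λ i → ≤-trans (≤-reflexive (*-distribˡ-sum (χ (not (U i))) (e i)))
                   (≤-trans (*-monoʳ-≤ (χ (not (U i))) (degree≤d i)) (≤-reflexive (*-comm (χ (not (U i))) d))))
                 (≤-reflexive (*-distribˡ-sum d (χ ∘ not ∘ U)))
    pointwise : ∀ i j → e i j ≤ χ (U i) * (χ (U j) * e i j) + (out i j + out j i)
    pointwise i j rewrite e-sym j i with U i | U j
    ... | true  | true  = ≤-trans (≤-reflexive (sym (trans (*-identityˡ _) (*-identityˡ (e i j))))) (m≤m+n _ _)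
    ... | true  | false = ≤-reflexive (sym (*-identityˡ (e i j)))
    ... | false | b     = ≤-trans (≤-reflexive (sym (*-identityˡ (e i j)))) (m≤m+n (1 * e i j) _)

-- Conversion sets of the composite

module LowerBound {n k : ℕ} (G : Graph n) (A : Graph (suc k)) (a : Fin (suc k)) (L : Linking G (A ∖ a))
                  (cubic : Cubic A) where
  open Graph A
  private
    module B = Graph (A ∖ a)
    H = compose G (A ∖ a) L
    module H = Graph H

  e : Fin k → Fin k → ℕ
  e i j = χ (does (i B.~? j))

  open Forest e (λ i j → cong χ (does-⇔ (mk⇔ B.~-sym B.~-sym) (i B.~? j) (j B.~? i))) (λ i → cong χ (dec-false (i B.~? i) B.~-irr))

  degree-total : sum (λ i → sum (e i)) + 3 ≡ 3 * k
  degree-total = begin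
    sum (λ i → sum (e i)) + 3
      ≡⟨ cong₂ _+_ (sum-cong-≗ (λ i → sym (degree-sum (A ∖ a) i))) (sym root-degree) ⟩
    sum B.degree + sum (λ i → χ (does (punchIn a i ~? a)))
      ≡⟨ sym (∑-distrib-+ B.degree (λ i → χ (does (punchIn a i ~? a)))) ⟩
    sum (λ i → B.degree i + χ (does (punchIn a i ~? a)))
      ≡⟨ sum-cong-≗ (degree-∖ A cubic a) ⟩
    sum {k} (λ _ → 3)
      ≡⟨ trans (sum-const k 3) (*-comm k 3) ⟩
    3 * k ∎
    where
    open ≡-Reasoning
    root-degree : sum (λ i → χ (does (punchIn a i ~? a))) ≡ 3
    root-degree = begin
      sum (λ i → χ (does (punchIn a i ~? a)))
        ≡⟨ sum-cong-≗ (λ i → cong χ (does-⇔ (mk⇔ ~-sym ~-sym) (punchIn a i ~? a) (a ~? punchIn a i))) ⟩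
      sum (λ i → χ (does (a ~? punchIn a i)))
        ≡⟨ cong (λ b → χ b + sum (λ i → χ (does (a ~? punchIn a i)))) (sym (dec-false (a ~? a) ~-irr)) ⟩
      χ (does (a ~? a)) + sum (λ i → χ (does (a ~? punchIn a i)))
        ≡⟨ sym (sum-remove {i = a} (λ x → χ (does (a ~? x)))) ⟩
      sum (λ x → χ (does (a ~? x)))
        ≡⟨ sym (degree-sum A a) ⟩
      degree a
        ≡⟨ cubic a ⟩
      3 ∎

  module _ (S : Subset (n * k)) (conversion : ConversionSet H S) (u : Fin n) where

    unconverted : Fin k → Bool
    unconverted i = not (lookup S (combine u i))

    -- The first member of W to be converted has at least two neighbours outside W.
    degenerate : Degenerate unconverted
    degenerate W W⊆ (i , Wi) =
      search (proj₁ conversion) i Wi (subst (combine u i ∈_) (sym (proj₂ conversion)) ∈⊤)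
      where
      P = process H S
      converted : ∀ {x t} → x ∈ P t → lookup (P t) x ≡ true
      converted = []=⇒lookup
      -- Goes back in time to the first stage that contains a member of `W`. Stage 0 is excluded,
      -- since `W` avoids `S`.
      search : ∀ t i → W i ≡ true → combine u i ∈ P t → ∃[ w ] (W w ≡ true × degreeIn W w ≤ 1)
      search zero i Wi i∈ = contradiction (trans (sym (W⊆ Wi)) (cong not ([]=⇒lookup i∈))) λ ()
      search (suc t) i Wi i∈ with any? (λ j → (W j Bool.≟ true) ×-dec (combine u j ∈? P t))
      ... | yes (j , Wj , j∈) = search t j Wj j∈
      ... | no none with x∈p∪q⁻ (P t) _ i∈
      ...   | inj₁ i∈Pt = contradiction (i , Wi , i∈Pt) none
      -- Of the three neighbours in the composite at least two are converted at stage `t`, hence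
      -- outside `W`, which leaves at most one in `W`.
      ...   | inj₂ i∈new = i , Wi , +-cancelˡ-≤ 2 _ _ (≤-trans (+-monoˡ-≤ (degreeIn W i) two) (≤-trans (+-monoʳ-≤ _ inside) (≤-reflexive total)))
        where
        x = combine u i
        N : Fin (n * k) → Bool
        N y = does (x H.~? y)
        old : Fin (n * k) → Bool
        old y = lookup (P t) y
        two : 2 ≤ sum (λ y → χ (N y ∧ old y))
        two = subst (2 ≤_) (trans ∣ H.neighbours x ∩ P t ∣-sum (sum-cong-≗ λ y → cong χ
                (trans (lookup-zipWith _∧_ y (H.neighbours x) (P t)) (cong (_∧ old y) (lookup∘tabulate N y)))))
              (does⇒ (2 ≤? _) (trans (sym (lookup∘tabulate _ x)) ([]=⇒lookup i∈new)))
        total : sum (λ y → χ (N y ∧ old y)) + sum (λ y → χ (N y ∧ not (old y))) ≡ 3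
        total = trans (sym (∑-distrib-+ (λ y → χ (N y ∧ old y)) (λ y → χ (N y ∧ not (old y)))))
          (trans (sum-cong-≗ λ y → partition (N y) (old y)) (trans (sym (degree-sum H x)) (compose-cubic A cubic a G L x)))
          where
          partition : ∀ b c → χ (b ∧ c) + χ (b ∧ not c) ≡ χ b
          partition true  true  = refl
          partition true  false = refl
          partition false c     = refl
        inside : degreeIn W i ≤ sum (λ y → χ (N y ∧ not (old y)))
        inside = ≤-trans (sum-mono in-copy) (≤-trans (term≤sum (λ v → sum (λ j → χ (N (combine {n} {k} v j) ∧ not (old (combine v j))))) u)
                   (≤-reflexive (sym (sum-combine n k (λ y → χ (N y ∧ not (old y)))))))
          where
          in-copy : ∀ j → χ (W j) * e i j ≤ χ (N (combine u j) ∧ not (old (combine u j)))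
          in-copy j with W j in Wj | i B.~? j
          ... | false | _    = z≤n
          ... | true  | no _ = z≤n
          ... | true  | yes p rewrite dec-true (x H.~? combine u j) (inner A cubic a G L u p) with old (combine u j) in j∈
          ...   | true  = contradiction (j , Wj , lookup⇒[]= _ (P t) j∈) none
          ...   | false = ≤-refl

    -- With `s` members of the set and `m + 1` other vertices in the copy, counting edge ends gives
    -- `3 k − 3 ≤ 2 m + 6 s`, that is, `k ≤ 4 s + 1`. The residue of `k` modulo 4 excludes `s ≤ j`.
    copy-bound : ∀ j → k ≡ 4 * j + 3 → suc j ≤ sum (λ i → χ (lookup S (combine u i)))
    copy-bound j k≡ with s ≤? j
      where s = sum (λ i → χ (lookup S (combine u i)))
    ... | no s≰j = ≰⇒> s≰j
    ... | yes s≤j = contradiction k≤ (<⇒≱ (begin-strict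
        4 * s + 1  ≤⟨ +-monoˡ-≤ 1 (*-monoʳ-≤ 4 s≤j) ⟩
        4 * j + 1  <⟨ +-monoʳ-< (4 * j) (s≤s (s≤s z≤n)) ⟩
        4 * j + 3  ≡⟨ sym k≡ ⟩
        k          ∎))
      where
      open ≤-Reasoning
      s = sum (λ i → χ (lookup S (combine u i)))
      m′ = sum (χ ∘ unconverted)
      s+m : s + m′ ≡ k
      s+m = trans (sym (∑-distrib-+ (λ i → χ (lookup S (combine u i))) (χ ∘ unconverted)))
        (trans (sum-cong-≗ (λ i → χ-not (lookup S (combine u i)))) (trans (sum-const k 1) (*-identityʳ k)))
        where
        χ-not : ∀ b → χ b + χ (not b) ≡ 1
        χ-not true  = refl
        χ-not false = refl
      edges≤ : ∀ i → sum (e i) ≤ 3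
      edges≤ i = subst (_≤ 3) (degree-sum (A ∖ a) i) (m+n≤o⇒m≤o _ (≤-reflexive (degree-∖ A cubic a i)))
      k≤ : k ≤ 4 * s + 1
      k≤ with m′ in count
      -- The forest bound needs a vertex outside the set; without one, `k` equals `s`.
      ... | zero = ≤-trans (≤-reflexive (trans (sym s+m) (trans (cong (s +_) count) (+-identityʳ s)))) (≤-trans (m≤n*m s 4) (m≤m+n (4 * s) 1))
      ... | suc m = begin
          k              ≡⟨ k≡s+1+m ⟩
          s + suc m      ≤⟨ +-monoʳ-≤ s (s≤s m≤3s) ⟩
          s + suc (3 * s)  ≡⟨ ring₁ s ⟩
          4 * s + 1      ∎
        where
        k≡s+1+m : k ≡ s + suc m
        k≡s+1+m = trans (sym s+m) (cong (s +_) count)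
        ring₁ : ∀ s → s + suc (3 * s) ≡ 4 * s + 1
        ring₁ = solve-∀
        ring₂ : ∀ s m → 2 * m + 3 + 3 * s + m ≡ 3 * (s + suc m)
        ring₂ = solve-∀
        ring₃ : ∀ s m → 2 * m + 2 * (3 * s) + 3 ≡ 2 * m + 3 + 3 * s + 3 * s
        ring₃ = solve-∀
        converted-count : sum (χ ∘ not ∘ unconverted) ≡ s
        converted-count = sum-cong-≗ (λ i → cong χ (Bool.not-involutive (lookup S (combine u i))))
        m≤3s : m ≤ 3 * s
        m≤3s = +-cancelˡ-≤ (2 * m + 3 + 3 * s) _ _ (begin
          2 * m + 3 + 3 * s + m                                           ≡⟨ ring₂ s m ⟩
          3 * (s + suc m)                                                 ≡⟨ cong (3 *_) (sym k≡s+1+m) ⟩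
          3 * k                                                           ≡⟨ sym degree-total ⟩
          sum (λ i → sum (e i)) + 3                                       ≤⟨ +-monoˡ-≤ 3 (total-bound 3 unconverted edges≤) ⟩
          edges² unconverted + 2 * (3 * sum (χ ∘ not ∘ unconverted)) + 3  ≡⟨ cong (λ x → edges² unconverted + 2 * (3 * x) + 3) converted-count ⟩
          edges² unconverted + 2 * (3 * s) + 3                            ≤⟨ +-monoˡ-≤ 3 (+-monoˡ-≤ (2 * (3 * s)) (forest-bound m unconverted count degenerate)) ⟩
          2 * m + 2 * (3 * s) + 3                                         ≡⟨ ring₃ s m ⟩
          2 * m + 3 + 3 * s + 3 * s                                       ∎)

  conversion-bound : ∀ j → k ≡ 4 * j + 3 → ∀ c → IsC₂ H c → n * suc j ≤ c
  conversion-bound j k≡ c ((S , conversion , refl) , _) = begin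
    n * suc j                                               ≡⟨ sym (sum-const n (suc j)) ⟩
    sum {n} (λ _ → suc j)                                   ≤⟨ sum-mono (λ u → copy-bound S conversion u j k≡) ⟩
    sum (λ u → sum (λ i → χ (lookup S (combine {n} {k} u i))))  ≡⟨ sym (sum-combine n k (χ ∘ lookup S)) ⟩
    sum (χ ∘ lookup S)                                      ≡⟨ sym ∣ S ∣-sum ⟩
    ∣ S ∣                                                   ∎
    where open ≤-Reasoning

-- From the counting bound to the ceiling

-- The ceiling unfolds to minus the floor `q` of `−x / 4`, so the claim is `−z ≤ q`. It follows from
-- `−4 z ≤ −x < 4 (q + 1)`.
ceiling-≤ : ∀ x z → x ≤ 4 * z → ceiling (ℤ.+ x / 4) ℤ.≤ ℤ.+ z
ceiling-≤ x z x≤4z = subst (ℤ._≤ ℤ.+ z) (cong ℤ.-_ (sym (ℤ.div-pos-is-/ℕ (ℤ.- ℤ.+ x) 4)))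
  (ℤ.≤-trans (ℤ.neg-mono-≤ -z≤) (ℤ.≤-reflexive (ℤ.neg-involutive (ℤ.+ z))))
  where
  q = (ℤ.- ℤ.+ x) ℤ./ℕ 4
  i<suc[j]⇒i≤j : ∀ {i j} → i ℤ.< ℤ.suc j → i ℤ.≤ j
  i<suc[j]⇒i≤j {i} {j} i< = subst (i ℤ.≤_) (ℤ.pred-suc j) (ℤ.i<j⇒i≤pred[j] i<)
  -z*4≡ : ℤ.- ℤ.+ z ℤ.* ℤ.+ 4 ≡ ℤ.- ℤ.+ (4 * z)
  -z*4≡ = trans (sym (ℤ.neg-distribˡ-* (ℤ.+ z) (ℤ.+ 4))) (cong ℤ.-_ (trans (sym (ℤ.pos-* z 4)) (cong ℤ.+_ (*-comm z 4))))
  -z≤ : ℤ.- ℤ.+ z ℤ.≤ q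
  -z≤ = i<suc[j]⇒i≤j (ℤ.*-cancelʳ-<-nonNeg (ℤ.+ 4)
    (ℤ.≤-<-trans (ℤ.≤-trans (ℤ.≤-reflexive -z*4≡) (ℤ.neg-mono-≤ (ℤ.+≤+ x≤4z))) (ℤ.n<s[n/ℕd]*d (ℤ.- ℤ.+ x) 4)))

-- Since `4 c ≥ n (k + 1) ≥ (n k + 2) + 4 m`, writing `c` as `m + c′` bounds the ceiling by `c′`.
gap : ∀ n k j m c → k ≡ 4 * j + 3 → 4 * m + 2 ≤ n → n * suc j ≤ c → ℤ.+ c ℤ.- ceiling (ℤ.+ (n * k + 2) / 4) ℤ.≥ ℤ.+ m
gap n k j m c refl 4m+2≤n n*j≤c with m≤n⇒∃[o]m+o≡n m≤c
  where
  m≤c : m ≤ c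
  m≤c = ≤-trans (m≤n*m m 4) (≤-trans (m≤m+n (4 * m) 2) (≤-trans 4m+2≤n (≤-trans (m≤m*n n (suc j)) n*j≤c)))
... | c′ , refl = ℤ.≤-trans (ℤ.≤-reflexive (sym cancel)) (ℤ.+-monoʳ-≤ (ℤ.+ (m + c′)) (ℤ.neg-mono-≤ (ceiling-≤ _ c′ bound)))
  where
  cancel : ℤ.+ (m + c′) ℤ.- ℤ.+ c′ ≡ ℤ.+ m
  cancel = trans (ℤ.m-n≡m⊖n (m + c′) c′) (trans (ℤ.⊖-≥ (m≤n+m c′ m)) (cong ℤ.+_ (m+n∸n≡m m c′)))
  expand : ∀ n j → n * (4 * j + 3) + n ≡ 4 * (n * suc j)
  expand = solve-∀
  regroup : ∀ m x → 4 * m + (x + 2) ≡ x + (4 * m + 2)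
  regroup = solve-∀
  bound : n * (4 * j + 3) + 2 ≤ 4 * c′
  bound = +-cancelˡ-≤ (4 * m) _ _ (begin
    4 * m + (n * (4 * j + 3) + 2)   ≡⟨ regroup m (n * (4 * j + 3)) ⟩
    n * (4 * j + 3) + (4 * m + 2)   ≤⟨ +-monoʳ-≤ (n * (4 * j + 3)) 4m+2≤n ⟩
    n * (4 * j + 3) + n             ≡⟨ expand n j ⟩
    4 * (n * suc j)                 ≤⟨ *-monoʳ-≤ 4 n*j≤c ⟩
    4 * (m + c′)                    ≡⟨ *-distribˡ-+ 4 m c′ ⟩
    4 * m + 4 * c′                  ∎)
    where open ≤-Reasoning

-- Reduced words acting on finite sets

Word : Set
Word = List (Fin 3)

-- Reduced words are the elements of the free product of three groups of order 2, whose Cayley graph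
-- is the cubic tree.
Reduced : Word → Set
Reduced = Linked _≢_

reduced-prefix : ∀ (v : Word) {w} → Reduced (v ++ w) → Reduced v
reduced-prefix []          _       = []
reduced-prefix (c ∷ [])    _       = [-]
reduced-prefix (c ∷ d ∷ v) (p ∷ r) = p ∷ reduced-prefix (d ∷ v) r

reduced-tail : ∀ {c} {w : Word} → Reduced (c ∷ w) → Reduced w
reduced-tail [-]     = []
reduced-tail (_ ∷ r) = r

run : ∀ {X : Set} → (Fin 3 → X → X) → Word → X → X
run act []      x = x
run act (c ∷ w) x = run act w (act c x)

-- The first letter is not counted: this concerns the nonempty reduced words of length at most g.
ReducedFree : ∀ {X : Set} → ℕ → (Fin 3 → X → X) → Set
ReducedFree g act = ∀ c w → Reduced (c ∷ w) → length w < g → ∀ x → run act (c ∷ w) x ≢ x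

iter : ∀ {X : Set} → ℕ → (X → X) → X → X
iter zero    f x = x
iter (suc n) f x = f (iter n f x)

iter-+ : ∀ {X : Set} m n (f : X → X) x → iter (m + n) f x ≡ iter m f (iter n f x)
iter-+ zero    n f x = refl
iter-+ (suc m) n f x = cong f (iter-+ m n f x)

-- Two consecutive steps along a path coloured alternately `c` and `d`.
turn : ∀ {X : Set} → (Fin 3 → X → X) → Fin 3 → Fin 3 → X → X
turn act c d x = act d (act c x)

TurnOrder : ∀ {X : Set} → ℕ → (Fin 3 → X → X) → Set
TurnOrder N act = ∀ {c d} → c ≢ d → ∀ x → iter N (turn act c d) x ≡ x

module _ {X Y : Set} {actX : Fin 3 → X → X} {actY : Fin 3 → Y → Y} (f : X → Y)
         (equivariant : ∀ c x → f (actX c x) ≡ actY c (f x)) where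

  run-equivariant : ∀ w x → f (run actX w x) ≡ run actY w (f x)
  run-equivariant []      x = refl
  run-equivariant (c ∷ w) x = trans (run-equivariant w (actX c x)) (cong (run actY w) (equivariant c x))

  iter-equivariant : ∀ N c d x → f (iter N (turn actX c d) x) ≡ iter N (turn actY c d) (f x)
  iter-equivariant zero    c d x = refl
  iter-equivariant (suc N) c d x =
    trans (equivariant d _) (cong (actY d) (trans (equivariant c _) (cong (actY c) (iter-equivariant N c d x))))

  reducedFree-pullback : ∀ {g} → ReducedFree g actY → ReducedFree g actX
  reducedFree-pullback free c w r l x closed = free c w r l (f x) (trans (sym (run-equivariant (c ∷ w) x)) (cong f closed))

-- The carrier is only a retract of `Fin size`. Redundant codes are harmless, because orbits contain
-- proper codes only, and each construction is spared a second round-trip law.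
record Action : Set₁ where
  field
    Carrier     : Set
    act         : Fin 3 → Carrier → Carrier
    involutive  : ∀ c x → act c (act c x) ≡ x
    size        : ℕ
    code        : Carrier → Fin size
    decode      : Fin size → Carrier
    decode-code : ∀ x → decode (code x) ≡ x

  code-injective : ∀ {x y} → code x ≡ code y → x ≡ y
  code-injective {x} {y} eq = trans (sym (decode-code x)) (trans (cong decode eq) (decode-code y))

_⊗_ : Action → Action → Action
X ⊗ Y = record
  { Carrier = X.Carrier × Y.Carrier
  ; act = λ c (x , y) → X.act c x , Y.act c y
  ; involutive = λ c (x , y) → cong₂ _,_ (X.involutive c x) (Y.involutive c y)
  ; size = X.size * Y.size
  ; code = λ (x , y) → combine (X.code x) (Y.code y)
  ; decode = λ i → X.decode (quotient Y.size i) , Y.decode (remainder {X.size} Y.size i)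
  ; decode-code = λ (x , y) → cong₂ _,_ (trans (cong (X.decode ∘ proj₁) (remQuot-combine (X.code x) (Y.code y))) (X.decode-code x))
                                        (trans (cong (Y.decode ∘ proj₂) (remQuot-combine (X.code x) (Y.code y))) (Y.decode-code y))
  }
  where
  module X = Action X
  module Y = Action Y

-- Binary vectors and homology covers

bool→fin : Bool → Fin 2
bool→fin false = zero
bool→fin true  = suc zero

fin→bool : Fin 2 → Bool
fin→bool zero    = false
fin→bool (suc _) = true

fin→bool→fin : ∀ b → fin→bool (bool→fin b) ≡ b
fin→bool→fin false = refl
fin→bool→fin true  = refl

bits→fin : ∀ {m} → Vec Bool m → Fin (2 ^ m)
bits→fin []      = zero
bits→fin (b ∷ v) = combine (bool→fin b) (bits→fin v)

fin→bits : ∀ m → Fin (2 ^ m) → Vec Bool m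
fin→bits zero    _ = []
fin→bits (suc m) i = fin→bool (quotient {2} (2 ^ m) i) ∷ fin→bits m (remainder {2} (2 ^ m) i)

fin→bits→fin : ∀ {m} (v : Vec Bool m) → fin→bits m (bits→fin v) ≡ v
fin→bits→fin []      = refl
fin→bits→fin {suc m} (b ∷ v) = cong₂ _∷_
  (trans (cong (fin→bool ∘ proj₁) (remQuot-combine (bool→fin b) (bits→fin v))) (fin→bool→fin b))
  (trans (cong (fin→bits m ∘ proj₂) (remQuot-combine (bool→fin b) (bits→fin v))) (fin→bits→fin v))

infixl 6 _⊕_
_⊕_ : ∀ {m} → Vec Bool m → Vec Bool m → Vec Bool m
_⊕_ = zipWith _xor_

⊕-assoc : ∀ {m} (u v w : Vec Bool m) → u ⊕ v ⊕ w ≡ u ⊕ (v ⊕ w)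
⊕-assoc = zipWith-assoc Bool.xor-assoc

⊕-cancel : ∀ {m} (u v : Vec Bool m) → u ⊕ v ⊕ v ≡ u
⊕-cancel []      []      = refl
⊕-cancel (a ∷ u) (b ∷ v) = cong₂ _∷_ (trans (Bool.xor-assoc a b b) (trans (cong (a xor_) (Bool.xor-same b)) (Bool.xor-identityʳ a))) (⊕-cancel u v)

-- The ℤ/2-homology cover: a bit for every edge records the parity of the number of its traversals.
module Cover (X : Action) where
  open Action X

  edge : Fin 3 → Carrier → Fin (3 * size)
  edge c x = combine c (code x)

  edge-injective : ∀ {c d x y} → edge c x ≡ edge d y → c ≡ d × x ≡ y
  edge-injective {c} {d} {x} {y} eq with p , q ← combine-injective c (code x) d (code y) eq = p , code-injective q

  δ : Fin (3 * size) → Vec Bool (3 * size)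
  δ e = tabulate (λ e′ → does (e ≟ e′))

  -- Both orientations of the edge are toggled, so that crossing it in either direction is the same toggle.
  toggle : Fin 3 → Carrier → Vec Bool (3 * size)
  toggle c x = δ (edge c x) ⊕ δ (edge c (act c x))

  toggle-act : ∀ c x → toggle c (act c x) ≡ toggle c x
  toggle-act c x rewrite involutive c x = zipWith-comm Bool.xor-comm (δ (edge c (act c x))) (δ (edge c x))

  cover-act : Fin 3 → Carrier × Vec Bool (3 * size) → Carrier × Vec Bool (3 * size)
  cover-act c (x , f) = act c x , f ⊕ toggle c x

  cover : Action
  cover = record
    { Carrier = Carrier × Vec Bool (3 * size)
    ; act = cover-act
    ; involutive = λ c (x , f) → cong₂ _,_ (involutive c x) (trans (cong (f ⊕ toggle c x ⊕_) (toggle-act c x)) (⊕-cancel f (toggle c x)))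
    ; size = size * 2 ^ (3 * size)
    ; code = λ (x , f) → combine (code x) (bits→fin f)
    ; decode = λ i → decode (quotient (2 ^ (3 * size)) i) , fin→bits (3 * size) (remainder {size} (2 ^ (3 * size)) i)
    ; decode-code = λ (x , f) → cong₂ _,_ (trans (cong (decode ∘ proj₁) (remQuot-combine (code x) (bits→fin f))) (decode-code x))
        (trans (cong (fin→bits (3 * size) ∘ proj₂) (remQuot-combine (code x) (bits→fin f))) (fin→bits→fin f))
    }

  -- The sum of the toggles met during `N` turns from `x`. It does not depend on the bits carried
  -- along, so a second closed round cancels the first.
  shift-of : ℕ → Fin 3 → Fin 3 → Carrier → Vec Bool (3 * size)
  shift-of zero    c d x = replicate _ false
  shift-of (suc N) c d x = let y = iter N (turn act c d) x in shift-of N c d x ⊕ (toggle c y ⊕ toggle d (act c y))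

  iter-cover : ∀ N c d x f → iter N (turn cover-act c d) (x , f) ≡ (iter N (turn act c d) x , f ⊕ shift-of N c d x)
  iter-cover zero    c d x f = cong (x ,_) (sym (zipWith-identityʳ Bool.xor-identityʳ f))
  iter-cover (suc N) c d x f rewrite iter-cover N c d x f =
    cong (_ ,_) (trans (⊕-assoc (f ⊕ s) t t′) (⊕-assoc f s (t ⊕ t′)))
    where
    y  = iter N (turn act c d) x
    s  = shift-of N c d x
    t  = toggle c y
    t′ = toggle d (act c y)

  -- Running twice around a cycle toggles every bit an even number of times.
  cover-turnOrder : ∀ {N} → TurnOrder N act → TurnOrder (2 * N) cover-act
  cover-turnOrder {N} order {c} {d} c≢d (x , f) = begin
    iter (N + (N + 0)) T (x , f)                                           ≡⟨ cong (λ M → iter (N + M) T (x , f)) (+-identityʳ N) ⟩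
    iter (N + N) T (x , f)                                                 ≡⟨ iter-+ N N T (x , f) ⟩
    iter N T (iter N T (x , f))                                            ≡⟨ cong (iter N T) (once f) ⟩
    iter N T (x , f ⊕ shift-of N c d x)                                    ≡⟨ once (f ⊕ shift-of N c d x) ⟩
    x , f ⊕ shift-of N c d x ⊕ shift-of N c d x                            ≡⟨ cong (x ,_) (⊕-cancel f _) ⟩
    x , f                                                                  ∎
    where
    open ≡-Reasoning
    T = turn cover-act c d
    once : ∀ f → iter N T (x , f) ≡ (x , f ⊕ shift-of N c d x)
    once f = trans (iter-cover N c d x f) (cong (_, f ⊕ shift-of N c d x) (order c≢d x))

  δ-hit : ∀ e → lookup (δ e) e ≡ true
  δ-hit e = trans (lookup∘tabulate (λ e′ → does (e ≟ e′)) e) (dec-true (e ≟ e) refl)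

  δ-miss : ∀ {e e′} → e ≢ e′ → lookup (δ e) e′ ≡ false
  δ-miss {e} {e′} e≢e′ = trans (lookup∘tabulate (λ e′ → does (e ≟ e′)) e′) (dec-false (e ≟ e′) e≢e′)

  lookup-toggle : ∀ f c x e → lookup (f ⊕ toggle c x) e ≡ lookup f e xor (lookup (δ (edge c x)) e xor lookup (δ (edge c (act c x))) e)
  lookup-toggle f c x e = trans (lookup-zipWith _xor_ e f _) (cong (lookup f e xor_) (lookup-zipWith _xor_ e (δ (edge c x)) _))

  -- The hypothesis says that no letter `c` of the word crosses the c-edge at `v` in either
  -- direction; letters of other colours toggle other bits.
  untouched : ∀ c v w x f →
    (∀ pre post → w ≡ pre ++ c ∷ post → run act pre x ≢ v × act c (run act pre x) ≢ v) →
    lookup (proj₂ (run cover-act w (x , f))) (edge c v) ≡ lookup f (edge c v)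
  untouched c v []      x f avoids = refl
  untouched c v (d ∷ w) x f avoids = begin
    lookup (proj₂ (run cover-act w (act d x , f ⊕ toggle d x))) (edge c v)
      ≡⟨ untouched c v w (act d x) (f ⊕ toggle d x) (λ pre post eq → avoids (d ∷ pre) post (cong (d ∷_) eq)) ⟩
    lookup (f ⊕ toggle d x) (edge c v)
      ≡⟨ lookup-toggle f d x (edge c v) ⟩
    lookup f (edge c v) xor (lookup (δ (edge d x)) (edge c v) xor lookup (δ (edge d (act d x))) (edge c v))
      ≡⟨ cong (lookup f (edge c v) xor_) (cong₂ _xor_ (δ-miss missˡ) (δ-miss missʳ)) ⟩
    lookup f (edge c v) xor false
      ≡⟨ Bool.xor-identityʳ _ ⟩
    lookup f (edge c v) ∎
    where
    open ≡-Reasoning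
    missˡ : edge d x ≢ edge c v
    missˡ eq with refl , x≡v ← edge-injective {d} {c} eq = proj₁ (avoids [] w refl) x≡v
    missʳ : edge d (act d x) ≢ edge c v
    missʳ eq with refl , x≡v ← edge-injective {d} {c} eq = proj₂ (avoids [] w refl) x≡v

  -- A closed reduced word of length g + 1 would cross its first edge only once.
  cover-reducedFree : ∀ {g} → 0 < g → ReducedFree g act → ReducedFree (suc g) cover-act
  cover-reducedFree {g} 0<g free c w red (s≤s length≤) (v , f) closed =
    not-≢ (lookup f e) (trans (sym first) (trans (sym (untouched c v w (act c v) (f ⊕ toggle c v) avoids)) (cong (λ s → lookup (proj₂ s) e) closed)))
    where
    e = edge c v
    not-≢ : ∀ b → not b ≢ b
    not-≢ true  ()
    not-≢ false ()
    flip-bit : ∀ b → b xor (true xor false) ≡ not b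
    flip-bit true  = refl
    flip-bit false = refl
    moved : edge c (act c v) ≢ e
    moved eq = free c [] [-] 0<g v (proj₂ (edge-injective {c} {c} eq))
    first : lookup (f ⊕ toggle c v) e ≡ not (lookup f e)
    first = trans (lookup-toggle f c v e) (trans (cong (lookup f e xor_) (cong₂ _xor_ (δ-hit e) (δ-miss moved))) (flip-bit (lookup f e)))
    -- A second crossing would start or end at `v`. In the first case `c ∷ pre` is closed at `v`; in
    -- the second `pre` is closed at `act c v`, and it is nonempty as the word is reduced. Both are
    -- too short.
    avoids : ∀ pre post → w ≡ pre ++ c ∷ post → run act pre (act c v) ≢ v × act c (run act pre (act c v)) ≢ v
    avoids pre post refl = free c pre (reduced-prefix (c ∷ pre) red) (≤-trans short length≤) v , returns pre red short
      where
      short : length pre < length (pre ++ c ∷ post)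
      short = subst (length pre <_) (sym (length-++ pre)) (m<m+n (length pre) (s≤s z≤n))
      returns : ∀ pre → Reduced (c ∷ pre ++ c ∷ post) → length pre < length w → act c (run act pre (act c v)) ≢ v
      returns []      (c≢c ∷ _) _  _  = c≢c refl
      returns (d ∷ pre) (_ ∷ red) l eq = free d pre (reduced-prefix (d ∷ pre) red) (≤-trans (≤-trans (n≤1+n _) l) length≤) (act c v)
        (trans (sym (involutive c _)) (cong (act c) eq))

-- Two vertices joined by three parallel edges: the base of the tower of covers.
flips : Action
flips = record
  { Carrier = Bool ; act = λ _ → not ; involutive = λ _ → Bool.not-involutive
  ; size = 2 ; code = bool→fin ; decode = fin→bool ; decode-code = fin→bool→fin }

tower : ℕ → Action
tower zero    = flips
tower (suc g) = Cover.cover (tower g)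

tower-turnOrder : ∀ g → TurnOrder (2 ^ g) (Action.act (tower g))
tower-turnOrder zero    _ = Bool.not-involutive
tower-turnOrder (suc g) = Cover.cover-turnOrder (tower g) {2 ^ g} (tower-turnOrder g)

tower-reducedFree : ∀ g → ReducedFree (suc g) (Action.act (tower g))
tower-reducedFree zero    c []      _ _        true  ()
tower-reducedFree zero    c []      _ _        false ()
tower-reducedFree zero    c (_ ∷ _) _ (s≤s ())
tower-reducedFree (suc g) = Cover.cover-reducedFree (tower g) (s≤s z≤n) (tower-reducedFree g)

-- Dihedral labels

module Rotation (N : ℕ) .{{_ : NonZero N}} where

  shift : ℕ → Fin N → Fin N
  shift s i = fromℕ< (m%n<n (toℕ i + s) N)

  toℕ-shift : ∀ s i → toℕ (shift s i) ≡ (toℕ i + s) % N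
  toℕ-shift s i = toℕ-fromℕ< (m%n<n (toℕ i + s) N)

  shift-shift : ∀ s t i → shift s (shift t i) ≡ shift (t + s) i
  shift-shift s t i = toℕ-injective (begin
    toℕ (shift s (shift t i))              ≡⟨ toℕ-shift s (shift t i) ⟩
    (toℕ (shift t i) + s) % N              ≡⟨ cong (λ x → (x + s) % N) (toℕ-shift t i) ⟩
    ((toℕ i + t) % N + s) % N              ≡⟨ %-distribˡ-+ ((toℕ i + t) % N) s N ⟩
    ((toℕ i + t) % N % N + s % N) % N      ≡⟨ cong (λ x → (x + s % N) % N) (m%n%n≡m%n (toℕ i + t) N) ⟩
    ((toℕ i + t) % N + s % N) % N          ≡⟨ sym (%-distribˡ-+ (toℕ i + t) s N) ⟩
    (toℕ i + t + s) % N                    ≡⟨ cong (_% N) (+-assoc (toℕ i) t s) ⟩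
    (toℕ i + (t + s)) % N                  ≡⟨ sym (toℕ-shift (t + s) i) ⟩
    toℕ (shift (t + s) i)                  ∎)
    where open ≡-Reasoning

  shift-multiple : ∀ k i → shift (k * N) i ≡ i
  shift-multiple k i = toℕ-injective (trans (toℕ-shift (k * N) i) (trans ([m+kn]%n≡m%n (toℕ i) k N) (m<n⇒m%n≡m (toℕ<n i))))

  shift-free : ∀ {s} → 0 < s → s < N → ∀ i → shift s i ≢ i
  shift-free {s} 0<s s<N i eq with toℕ i + s <? N
  ... | yes small = <⇒≢ (m<m+n (toℕ i) 0<s) (sym (trans (sym (m<n⇒m%n≡m small)) (trans (sym (toℕ-shift s i)) (cong toℕ eq))))
  ... | no large with t , eq′ ← m≤n⇒∃[o]m+o≡n (≮⇒≥ large) = <⇒≢ s<N (+-cancelˡ-≡ (toℕ i) s N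
    (trans (sym eq′) (trans (+-comm N t) (cong (_+ N) (trans (sym remainder-t) (trans (sym (toℕ-shift s i)) (cong toℕ eq)))))))
    where
    t<N : t < N
    t<N = +-cancelˡ-< N t N (subst (_< N + N) (sym eq′) (+-mono-< (toℕ<n i) s<N))
    remainder-t : (toℕ i + s) % N ≡ t
    remainder-t = trans (cong (_% N) (trans (sym eq′) (+-comm N t))) (trans ([m+n]%n≡m%n t N) (m<n⇒m%n≡m t<N))

iter-involution : ∀ {X : Set} (f : X → X) → (∀ x → f (f x) ≡ x) → ∀ M x → iter (2 * M) f x ≡ x
iter-involution f inv M x = subst (λ K → iter K f x ≡ x) (*-comm M 2) (even M)
  where
  even : ∀ M → iter (M * 2) f x ≡ x
  even zero    = refl
  even (suc M) = trans (inv (iter (M * 2) f x)) (even M)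

-- The 2N-cycle with its edges coloured alternately 1 and 2; colour 0 acts trivially.
module Dihedral (N : ℕ) .{{_ : NonZero N}} where
  open Rotation N

  Label : Set
  Label = Bool × Fin N

  -- `N ∸ 1` stands for -1 modulo `N`. The opposite rotations on the two halves make colour 2 an
  -- involution.
  amount : Bool → ℕ
  amount false = N ∸ 1
  amount true  = 1

  dihedral : Fin 3 → Label → Label
  dihedral zero             l       = l
  dihedral (suc zero)       (b , i) = not b , i
  dihedral (suc (suc zero)) (b , i) = not b , shift (amount b) i

  amount-not : ∀ b → amount b + amount (not b) ≡ N
  amount-not false = m∸n+n≡m (>-nonZero⁻¹ N)
  amount-not true  = m+[n∸m]≡n (>-nonZero⁻¹ N)

  dihedral-involutive : ∀ c l → dihedral c (dihedral c l) ≡ l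
  dihedral-involutive zero             l       = refl
  dihedral-involutive (suc zero)       (b , i) = cong (_, i) (Bool.not-involutive b)
  dihedral-involutive (suc (suc zero)) (b , i) = cong₂ _,_ (Bool.not-involutive b)
    (trans (shift-shift (amount (not b)) (amount b) i) (trans (cong (λ s → shift s i) (trans (amount-not b) (sym (*-identityˡ N)))) (shift-multiple 1 i)))

  parity-flips : ∀ c → c ≢ zero → ∀ l → proj₁ (dihedral c l) ≡ not (proj₁ l)
  parity-flips zero             c≢0 l = contradiction refl c≢0
  parity-flips (suc zero)       c≢0 l = refl
  parity-flips (suc (suc zero)) c≢0 l = refl

  turn-12 : ∀ j b i → iter j (turn dihedral (suc zero) (suc (suc zero))) (b , i) ≡ (b , shift (j * amount (not b)) i)
  turn-12 zero    b i = cong (b ,_) (sym (shift-multiple 0 i))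
  turn-12 (suc j) b i rewrite turn-12 j b i = cong₂ _,_ (Bool.not-involutive b)
    (trans (shift-shift (amount (not b)) (j * amount (not b)) i) (cong (λ t → shift t i) (+-comm (j * amount (not b)) (amount (not b)))))

  turn-21 : ∀ j b i → iter j (turn dihedral (suc (suc zero)) (suc zero)) (b , i) ≡ (b , shift (j * amount b) i)
  turn-21 zero    b i = cong (b ,_) (sym (shift-multiple 0 i))
  turn-21 (suc j) b i rewrite turn-21 j b i = cong₂ _,_ (Bool.not-involutive b)
    (trans (shift-shift (amount b) (j * amount b) i) (cong (λ t → shift t i) (+-comm (j * amount b) (amount b))))

  amount-free : ∀ b {j} → 0 < j → j < N → ∀ i → shift (j * amount b) i ≢ i
  amount-free true  {j} 0<j j<N i eq = shift-free 0<j j<N i (trans (cong (λ t → shift t i) (sym (*-identityʳ j))) eq)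
  amount-free false {j} 0<j j<N i eq = shift-free 0<j j<N i (begin
    shift j i                         ≡⟨ cong (shift j) (sym eq) ⟩
    shift j (shift (j * (N ∸ 1)) i)   ≡⟨ shift-shift j (j * (N ∸ 1)) i ⟩
    shift (j * (N ∸ 1) + j) i         ≡⟨ cong (λ t → shift t i) total ⟩
    shift (j * N) i                   ≡⟨ shift-multiple j i ⟩
    i                                 ∎)
    where
    open ≡-Reasoning
    total : j * (N ∸ 1) + j ≡ j * N
    total = trans (cong (j * (N ∸ 1) +_) (sym (*-identityʳ j))) (trans (sym (*-distribˡ-+ j (N ∸ 1) 1)) (cong (j *_) (amount-not false)))

  turn-free : ∀ {c d} → c ≢ d → c ≢ zero → d ≢ zero → ∀ {j} → 0 < j → j < N → ∀ l → iter j (turn dihedral c d) l ≢ l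
  turn-free {zero}             {_}              _   c≢0 _   _ _ _ _ = c≢0 refl
  turn-free {_}                {zero}           _   _   d≢0 _ _ _ _ = d≢0 refl
  turn-free {suc zero}         {suc zero}       c≢d _   _   _ _ _ _ = c≢d refl
  turn-free {suc (suc zero)}   {suc (suc zero)} c≢d _   _   _ _ _ _ = c≢d refl
  turn-free {suc zero}         {suc (suc zero)} _ _ _ {j} 0<j j<N (b , i) eq = amount-free (not b) 0<j j<N i (cong proj₂ (trans (sym (turn-12 j b i)) eq))
  turn-free {suc (suc zero)}   {suc zero}       _ _ _ {j} 0<j j<N (b , i) eq = amount-free b 0<j j<N i (cong proj₂ (trans (sym (turn-21 j b i)) eq))

  -- When one of the two letters acts trivially, a turn is an involution. This case asks for an even
  -- `N`.
  turn-order : ∀ {M} → N ≡ 2 * M → TurnOrder N dihedral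
  turn-order {M} even {zero}           {d}              _   l = subst (λ K → iter K (dihedral d) l ≡ l) (sym even) (iter-involution (dihedral d) (dihedral-involutive d) M l)
  turn-order {M} even {suc c}          {zero}           _   l = subst (λ K → iter K (dihedral (suc c)) l ≡ l) (sym even) (iter-involution (dihedral (suc c)) (dihedral-involutive (suc c)) M l)
  turn-order even {suc zero}       {suc zero}       c≢d _ = contradiction refl c≢d
  turn-order even {suc (suc zero)} {suc (suc zero)} c≢d _ = contradiction refl c≢d
  turn-order even {suc zero}       {suc (suc zero)} _ (b , i) = trans (turn-12 N b i) (cong (b ,_) (trans (cong (λ t → shift t i) (*-comm N (amount (not b)))) (shift-multiple (amount (not b)) i)))
  turn-order even {suc (suc zero)} {suc zero}       _ (b , i) = trans (turn-21 N b i) (cong (b ,_) (trans (cong (λ t → shift t i) (*-comm N (amount b))) (shift-multiple (amount b) i)))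

-- Renames the colours so that `r` becomes the letter with trivial action on the 2N-cycle.
role : Fin 3 → Fin 3 → Fin 3
role r = transpose r zero

role-self : ∀ r → role r r ≡ zero
role-self r rewrite dec-true (r ≟ r) refl = refl

role-injective : ∀ r {c d} → role r c ≡ role r d → c ≡ d
role-injective r {c} {d} eq = trans (sym (transpose-inverse zero r)) (trans (cong (transpose zero r) eq) (transpose-inverse zero r))

role≢0 : ∀ r {c} → c ≢ r → role r c ≢ zero
role≢0 r c≢r eq = c≢r (role-injective r (trans eq (sym (role-self r))))

module _ (N : ℕ) .{{_ : NonZero N}} where
  open Dihedral N

  cycle-action : Fin 3 → Action
  cycle-action r = record
    { Carrier = Label ; act = λ c → dihedral (role r c) ; involutive = λ c → dihedral-involutive (role r c)
    ; size = 2 * N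
    ; code = λ (b , i) → combine (bool→fin b) i
    ; decode = λ x → fin→bool (quotient N x) , remainder {2} N x
    ; decode-code = λ (b , i) → cong₂ _,_ (trans (cong (fin→bool ∘ proj₁) (remQuot-combine (bool→fin b) i)) (fin→bool→fin b)) (cong proj₂ (remQuot-combine (bool→fin b) i)) }

⊗-iter : ∀ X Y → let open Action in ∀ n c d x y → iter n (turn (act (X ⊗ Y)) c d) (x , y) ≡ (iter n (turn (act X) c d) x , iter n (turn (act Y) c d) y)
⊗-iter X Y zero    c d x y = refl
⊗-iter X Y (suc n) c d x y rewrite ⊗-iter X Y n c d x y = refl

⊗-turnOrder : ∀ X Y {N} → TurnOrder N (Action.act X) → TurnOrder N (Action.act Y) → TurnOrder N (Action.act (X ⊗ Y))
⊗-turnOrder X Y {N} p q {c} {d} c≢d (x , y) = trans (⊗-iter X Y N c d x y) (cong₂ _,_ (p c≢d x) (q c≢d y))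

-- A connected 3-edge-coloured graph together with all that the graph theory needs: `free` for the
-- girth, and three equivariant labels which, with `turnOrder`, make each bicoloured cycle wrap
-- exactly once around the 2N-cycle of the third colour.
record Scheme (g n : ℕ) : Set₁ where
  field
    N           : ℕ
    {{nonZero}} : NonZero N
    large       : suc g < N
    act         : Fin 3 → Fin n → Fin n
    involutive  : ∀ c x → act c (act c x) ≡ x
    label       : Fin 3 → Fin n → Dihedral.Label N
    label-act   : ∀ r c x → label r (act c x) ≡ Dihedral.dihedral N (role r c) (label r x)
    turnOrder   : TurnOrder N act
    free        : ReducedFree g act
    root        : Fin n
    reach       : ∀ x → ∃[ w ] run act w root ≡ x

-- A finite orbit

module Orbit (Z : Action) (origin : Action.Carrier Z) where
  open Action Z

  next : Fin 3 → Fin size → Fin size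
  next c x = code (act c (decode x))

  reached? : ∀ S y → Dec (∃[ x ] (x ∈ S × ∃[ c ] next c x ≡ y))
  reached? S y = any? (λ x → (x ∈? S) ×-dec any? (λ c → next c x ≟ y))

  grow : Subset size → Subset size
  grow S = S ∪ tabulate (λ y → does (reached? S y))

  ball : ℕ → Subset size
  ball zero    = ⁅ code origin ⁆
  ball (suc t) = grow (ball t)

  open Stabilisation grow (λ S → p⊆p∪q _) ball (λ _ → refl)

  orbit : Subset size
  orbit = ball size

  ball⇒run : ∀ t {y} → y ∈ ball t → ∃[ w ] y ≡ code (run act w origin)
  ball⇒run zero    y∈ = [] , x∈⁅y⁆⇒x≡y _ y∈
  ball⇒run (suc t) {y} y∈ with x∈p∪q⁻ (ball t) _ y∈
  ... | inj₁ y∈ball = ball⇒run t y∈ball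
  ... | inj₂ y∈new with x , x∈ , c , refl ← does⇒ (reached? (ball t) y) (trans (sym (lookup∘tabulate _ y)) ([]=⇒lookup y∈new))
                   with w , refl ← ball⇒run t x∈ =
    w ++ c ∷ [] , cong code (trans (cong (act c) (decode-code _)) (sym (run-++ w origin)))
    where
    run-++ : ∀ w x → run act (w ++ c ∷ []) x ≡ act c (run act w x)
    run-++ []      x = refl
    run-++ (d ∷ w) x = run-++ w (act d x)

  next∈orbit : ∀ c {x} → x ∈ orbit → next c x ∈ orbit
  next∈orbit c {x} x∈ = subst (next c x ∈_) stable (x∈p∪q⁺ (inj₂ (lookup⇒[]= _ _
    (trans (lookup∘tabulate _ (next c x)) (dec-true (reached? orbit (next c x)) (x , x∈ , c , refl))))))

  order : ℕ
  order = sum (χ ∘ lookup orbit)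

  open Enumeration (enumerate (lookup orbit))

  elem∈ : ∀ i → elem i ∈ orbit
  elem∈ i = lookup⇒[]= (elem i) orbit (sound i)

  index : ∀ {y} → y ∈ orbit → ∃[ i ] elem i ≡ y
  index {y} y∈ = complete y ([]=⇒lookup y∈)

  state : Fin order → Carrier
  state i = decode (elem i)

  -- `code ∘ decode` need not be the identity on all codes, but every member of the orbit is the
  -- code of a state reached by a word.
  code-state : ∀ i → code (state i) ≡ elem i
  code-state i with w , eq ← ball⇒run size (elem∈ i) =
    trans (cong (code ∘ decode) eq) (trans (cong code (decode-code _)) (sym eq))

  state-injective : ∀ {i j} → state i ≡ state j → i ≡ j
  state-injective {i} {j} eq = injective (trans (sym (code-state i)) (trans (cong code eq) (code-state j)))

  move : Fin 3 → Fin order → Fin order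
  move c i = proj₁ (index (next∈orbit c (elem∈ i)))

  state-move : ∀ c i → state (move c i) ≡ act c (state i)
  state-move c i = trans (cong decode (proj₂ (index (next∈orbit c (elem∈ i))))) (decode-code _)

  origin∈orbit : code origin ∈ orbit
  origin∈orbit = bounded 0 (x∈⁅x⁆ (code origin))

  root : Fin order
  root = proj₁ (index origin∈orbit)

  state-root : state root ≡ origin
  state-root = trans (cong decode (proj₂ (index origin∈orbit))) (decode-code origin)

  reach : ∀ i → ∃[ w ] run move w root ≡ i
  reach i with w , eq ← ball⇒run size (elem∈ i) = w , state-injective (begin
    state (run move w root)               ≡⟨ run-equivariant {actX = move} {actY = act} state state-move w root ⟩
    run act w (state root)                ≡⟨ cong (run act w) state-root ⟩
    run act w origin                      ≡⟨ sym (decode-code _) ⟩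
    decode (code (run act w origin))      ≡⟨ cong decode (sym eq) ⟩
    state i                               ∎)
    where open ≡-Reasoning

module Construction (g : ℕ) where
  N : ℕ
  -- The turn order of `tower (suc g)`. The positive exponent makes it even, as the labels require,
  -- and it exceeds `suc g`.
  N = 2 ^ suc g

  instance
    nonZero : NonZero N
    nonZero = m^n≢0 2 (suc g)

  open Dihedral N

  cycles₁₂ cycles total : Action
  cycles₁₂ = cycle-action N (suc zero) ⊗ cycle-action N (suc (suc zero))
  cycles   = cycle-action N zero ⊗ cycles₁₂
  total    = tower (suc g) ⊗ cycles

  label : Fin 3 → Action.Carrier total → Label
  label zero             (_ , l , _)     = l
  label (suc zero)       (_ , _ , l , _) = l
  label (suc (suc zero)) (_ , _ , _ , l) = l

  label-act : ∀ r c z → label r (Action.act total c z) ≡ dihedral (role r c) (label r z)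
  label-act zero             c z = refl
  label-act (suc zero)       c z = refl
  label-act (suc (suc zero)) c z = refl

  cycle-turnOrder : ∀ r → TurnOrder N (Action.act (cycle-action N r))
  cycle-turnOrder r c≢d = turn-order {2 ^ g} refl (c≢d ∘ role-injective r)

  total-turnOrder : TurnOrder N (Action.act total)
  total-turnOrder = ⊗-turnOrder (tower (suc g)) cycles {N} (tower-turnOrder (suc g))
    (⊗-turnOrder (cycle-action N zero) cycles₁₂ {N} (cycle-turnOrder zero)
      (⊗-turnOrder (cycle-action N (suc zero)) (cycle-action N (suc (suc zero))) {N} (cycle-turnOrder (suc zero)) (cycle-turnOrder (suc (suc zero)))))

  total-free : ReducedFree (suc (suc g)) (Action.act total)
  total-free = reducedFree-pullback {actX = Action.act total} {actY = Action.act (tower (suc g))} proj₁ (λ _ _ → refl) (tower-reducedFree (suc g))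

  inhabitant : ∀ h → Action.Carrier (tower h)
  inhabitant zero    = true
  inhabitant (suc h) = inhabitant h , replicate _ false

  start : Label
  start = false , fromℕ< (>-nonZero⁻¹ N)

  open Orbit total (inhabitant (suc g) , start , start , start)

  n<2^n : ∀ n → n < 2 ^ n
  n<2^n zero    = s≤s z≤n
  n<2^n (suc n) = +-mono-≤ (m^n>0 2 n) (≤-trans (n<2^n n) (m≤m+n _ 0))

  scheme : ∃ (Scheme g)
  scheme = order , record
    { N = N
    ; large = n<2^n (suc g)
    ; act = move
    ; involutive = λ c x → state-injective (trans (state-move c _) (trans (cong (Action.act total c) (state-move c x)) (Action.involutive total c (state x))))
    ; label = λ r x → label r (state x)
    ; label-act = λ r c x → trans (cong (label r) (state-move c x)) (label-act r c (state x))
    ; turnOrder = λ {c} {d} c≢d x → state-injective (trans (iter-equivariant {actX = move} {actY = Action.act total} state state-move N c d x) (total-turnOrder c≢d (state x)))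
    ; free = λ c w r l → reducedFree-pullback {actX = move} {actY = Action.act total} state state-move total-free c w r (≤-trans l (≤-trans (n≤1+n _) (n≤1+n _)))
    ; root = root
    ; reach = reach
    }

-- The 3-connected graph of a scheme

-- Cardinality at most 2 in pigeonhole form, which passes to derived predicates such as `Dirty` and
-- `Image` without any counting.
AtMostTwo : ∀ {X : Set} → (X → Set) → Set
AtMostTwo R = ∀ {x y z} → R x → R y → R z → x ≡ y ⊎ y ≡ z ⊎ x ≡ z

another-colour : ∀ (c : Fin 3) → ∃[ d ] d ≢ c
another-colour zero    = suc zero , λ ()
another-colour (suc c) = zero , λ ()

third-colour : ∀ {c d : Fin 3} → c ≢ d → ∃[ e ] (e ≢ c × e ≢ d)
third-colour {zero}           {zero}           c≢d = contradiction refl c≢d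
third-colour {zero}           {suc zero}       _   = suc (suc zero) , (λ ()) , (λ ())
third-colour {zero}           {suc (suc zero)} _   = suc zero , (λ ()) , (λ ())
third-colour {suc zero}       {zero}           _   = suc (suc zero) , (λ ()) , (λ ())
third-colour {suc zero}       {suc zero}       c≢d = contradiction refl c≢d
third-colour {suc zero}       {suc (suc zero)} _   = zero , (λ ()) , (λ ())
third-colour {suc (suc zero)} {zero}           _   = suc zero , (λ ()) , (λ ())
third-colour {suc (suc zero)} {suc zero}       _   = zero , (λ ()) , (λ ())
third-colour {suc (suc zero)} {suc (suc zero)} c≢d = contradiction refl c≢d

module SchemeGraph {g n : ℕ} (scheme : Scheme g n) where
  open Scheme scheme
  open Dihedral N

  act-injective : ∀ c {x y} → act c x ≡ act c y → x ≡ y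
  act-injective c {x} {y} eq = trans (sym (involutive c x)) (trans (cong (act c) eq) (involutive c y))

  parity : Fin 3 → Fin n → Bool
  parity r x = proj₁ (label r x)

  parity-act : ∀ {r c} → c ≢ r → ∀ x → parity r (act c x) ≡ not (parity r x)
  parity-act {r} {c} c≢r x = trans (cong proj₁ (label-act r c x)) (parity-flips (role r c) (role≢0 r c≢r) (label r x))

  label-fixed : ∀ r x → label r (act r x) ≡ label r x
  label-fixed r x = trans (label-act r r x) (cong (λ c → dihedral c (label r x)) (role-self r))

  parity-differs : ∀ r {x y} → parity r x ≡ not (parity r y) → x ≢ y
  parity-differs r {x} eq refl = Bool.not-¬ refl eq

  act≢ : ∀ c x → act c x ≢ x
  act≢ c x with r , r≢c ← another-colour c = parity-differs r (parity-act (≢-sym r≢c) x)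

  -- Label `c` is fixed by `c`, whereas every other colour flips its parity; so there are no
  -- parallel edges.
  act-distinct : ∀ {c d x} → act c x ≡ act d x → c ≡ d
  act-distinct {c} {d} {x} eq with c ≟ d
  ... | yes c≡d = c≡d
  ... | no  c≢d = contradiction (trans (sym (cong proj₁ (label-fixed c x))) (trans (cong (parity c) eq) (parity-act (≢-sym c≢d) x))) (Bool.not-¬ refl)

  graph : Graph n
  graph = record
    { _~_   = λ u v → ∃[ c ] act c u ≡ v
    ; _~?_  = λ u v → any? (λ c → act c u ≟ v)
    ; ~-sym = λ { {u} (c , refl) → c , involutive c u }
    ; ~-irr = λ { {v} (c , eq) → act≢ c v eq }
    }

  open Graph graph using (_~_; _~?_; ~-sym)

  cubic : Cubic graph
  cubic v = trans (degree-sum graph v) (enumeration-size record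
    { elem = λ c → act c v ; injective = act-distinct ; sound = λ c → dec-true (v ~? act c v) (c , refl)
    ; complete = λ u t → does⇒ (v ~? u) t })

  private
    same : Bool → Bool → Bool
    same b c = not (b xor c)

    same-not : ∀ b c → same b (not c) ≡ same (not b) c
    same-not b c = cong not (trans (sym (Bool.not-distribʳ-xor b c)) (Bool.not-distribˡ-xor b c))

    cell : Bool → Bool → ℕ
    cell p q = sum (λ x → χ (same p (parity zero x)) * χ (same q (parity (suc zero) x)))

    permuted : ∀ c (f : Fin n → ℕ) → sum f ≡ sum (f ∘ act c)
    permuted c f = sum-permute f (permutation (act c) (act c) (involutive c) (involutive c))

    cell-notˡ : ∀ p q → cell p q ≡ cell (not p) q
    cell-notˡ p q = trans (permuted (suc zero) (λ x → χ (same p (parity zero x)) * χ (same q (parity (suc zero) x)))) (sum-cong-≗ λ x → cong₂ (λ b c → χ b * χ c)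
      (trans (cong (same p) (parity-act (λ ()) x)) (same-not p (parity zero x)))
      (cong (same q) (cong proj₁ (label-fixed (suc zero) x))))

    cell-notʳ : ∀ p q → cell p q ≡ cell p (not q)
    cell-notʳ p q = trans (permuted zero (λ x → χ (same p (parity zero x)) * χ (same q (parity (suc zero) x)))) (sum-cong-≗ λ x → cong₂ (λ b c → χ b * χ c)
      (cong (same p) (cong proj₁ (label-fixed zero x)))
      (trans (cong (same q) (parity-act (λ ()) x)) (same-not q (parity (suc zero) x))))

  -- The parities of the labels 0 and 1 split the vertices into four classes, which the involutions permute transitively.
  order-divisible : ∃[ K ] n ≡ 4 * K
  order-divisible = K , (begin
    n                                ≡⟨ trans (sym (*-identityʳ n)) (sym (sum-const n 1)) ⟩
    sum {n} (λ _ → 1)                ≡⟨ sum-cong-≗ (λ x → partition (parity zero x) (parity (suc zero) x)) ⟩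
    sum (λ x → (f true true x + f false true x) + (f true false x + f false false x))
      ≡⟨ ∑-distrib-+ (λ x → f true true x + f false true x) (λ x → f true false x + f false false x) ⟩
    sum (λ x → f true true x + f false true x) + sum (λ x → f true false x + f false false x)
      ≡⟨ cong₂ _+_ (∑-distrib-+ (f true true) (f false true)) (∑-distrib-+ (f true false) (f false false)) ⟩
    (K + cell false true) + (cell true false + cell false false)
      ≡⟨ cong₂ _+_ (cong (K +_) (sym (cell-notˡ true true)))
                   (cong₂ _+_ (sym (cell-notʳ true true)) (trans (sym (cell-notˡ true false)) (sym (cell-notʳ true true)))) ⟩
    (K + K) + (K + K)                ≡⟨ +-assoc K K (K + K) ⟩
    K + (K + (K + K))                ≡⟨ cong (λ x → K + (K + (K + x))) (sym (+-identityʳ K)) ⟩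
    4 * K                            ∎)
    where
    open ≡-Reasoning
    K = cell true true
    f : Bool → Bool → Fin n → ℕ
    f p q x = χ (same p (parity zero x)) * χ (same q (parity (suc zero) x))
    partition : ∀ p q → 1 ≡ (χ (same true p) * χ (same true q) + χ (same false p) * χ (same true q))
                          + (χ (same true p) * χ (same false q) + χ (same false p) * χ (same false q))
    partition true  true  = refl
    partition true  false = refl
    partition false true  = refl
    partition false false = refl

  -- The bicoloured cycle through `x`, starting along `p`. Label `r` of the third colour runs round
  -- its own 2N-cycle in step with it and tells its vertices apart.
  module Rotate {p q : Fin 3} (p≢q : p ≢ q) (x : Fin n) where

    even odd : ℕ → Fin n
    even j = iter j (turn act p q) x
    odd j  = act p (even j)

    r : Fin 3
    r = proj₁ (third-colour p≢q)

    r≢p : r ≢ p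
    r≢p = proj₁ (proj₂ (third-colour p≢q))

    r≢q : r ≢ q
    r≢q = proj₂ (proj₂ (third-colour p≢q))

    T : Label → Label
    T = turn dihedral (role r p) (role r q)

    label-even : ∀ j → label r (even j) ≡ iter j T (label r x)
    label-even j = iter-equivariant {actX = act} {actY = dihedral ∘ role r} (label r) (label-act r) j p q x

    parity-even : ∀ j → parity r (even j) ≡ parity r x
    parity-even zero    = refl
    parity-even (suc j) = trans (parity-act (≢-sym r≢q) _) (trans (cong not (parity-act (≢-sym r≢p) _)) (trans (Bool.not-involutive _) (parity-even j)))

    parity-odd : ∀ j → parity r (odd j) ≡ not (parity r x)
    parity-odd j = trans (parity-act (≢-sym r≢p) _) (cong not (parity-even j))

    T-free : ∀ {j} → 0 < j → j < N → iter j T (label r x) ≢ label r x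
    T-free 0<j j<N = turn-free (p≢q ∘ role-injective r) (role≢0 r (≢-sym r≢p)) (role≢0 r (≢-sym r≢q)) 0<j j<N (label r x)

    even≢ : ∀ {j} → 0 < j → j < N → even j ≢ x
    even≢ {j} 0<j j<N eq = T-free 0<j j<N (trans (sym (label-even j)) (cong (label r) eq))

    odd≢ : ∀ j → odd j ≢ x
    odd≢ j = parity-differs r (parity-odd j)

    -- After `N` turns the cycle is back at `x`, so the vertex just before is the neighbour of `x`
    -- along `q`.
    last : ∀ {j} → suc j ≡ N → odd j ≡ act q x
    last {j} refl = trans (sym (involutive q (odd j))) (cong (act q) (turnOrder p≢q x))

  -- One bicoloured cycle already has `N` distinct even vertices. A large `N` thus forces a large
  -- order.
  N≤n : N ≤ n
  N≤n = injective⇒≤ {f = even ∘ toℕ} even-injective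
    where
    open Rotate {zero} {suc zero} (λ ()) root
    iter-injective : ∀ j {y z} → iter j (turn act zero (suc zero)) y ≡ iter j (turn act zero (suc zero)) z → y ≡ z
    iter-injective zero    eq = eq
    iter-injective (suc j) eq = iter-injective j (act-injective zero (act-injective (suc zero) eq))
    later : ∀ {i j} → i < j → j < N → even i ≢ even j
    later {i} i<j j<N eq with d , refl ← m≤n⇒∃[o]m+o≡n (<⇒≤ i<j) =
      even≢ (+-cancelˡ-< i 0 d (subst (_< i + d) (sym (+-identityʳ i)) i<j)) (≤-trans (s≤s (m≤n+m d i)) j<N)
        (sym (iter-injective i (trans eq (iter-+ i d _ root))))
    even-injective : Injective _≡_ _≡_ (even ∘ toℕ {N})
    even-injective {i} {j} eq with <-cmp (toℕ i) (toℕ j)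
    ... | tri< i<j _ _ = contradiction eq (later i<j (toℕ<n j))
    ... | tri≈ _ i≡j _ = toℕ-injective i≡j
    ... | tri> _ _ j<i = contradiction (sym eq) (later j<i (toℕ<n i))

  connected : ∀ u v → Star _~_ u v
  connected u v with w , refl ← reach u | w′ , refl ← reach v = reverse ~-sym (walk w root) ◅◅ walk w′ root
    where
    walk : ∀ w x → Star _~_ x (run act w x)
    walk []      x = ε
    walk (c ∷ w) x = (c , refl) ◅ walk w (act c x)

  -- Bypassing at most two removed vertices

  module Removal (R : Fin n → Set) (R? : ∀ x → Dec (R x)) (two : AtMostTwo R) where

    Step : Fin n → Fin n → Set
    Step u v = ¬ R u × ¬ R v × u ~ v

    Joined : Fin n → Fin n → Set
    Joined = Star Step

    flip-step : ∀ {u v} → Step u v → Step v u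
    flip-step (¬u , ¬v , e) = ¬v , ¬u , ~-sym e

    -- If `x` is the only removed vertex, `x` is its own partner, so the case of a single removal
    -- needs no separate treatment.
    partner : ∀ {x} → R x → ∃[ y ] (R y × (∀ {z} → R z → z ≡ x ⊎ z ≡ y))
    partner {x} Rx with any? (λ y → R? y ×-dec ¬? (y ≟ x))
    ... | yes (y , Ry , y≢x) = y , Ry , choose
      where
      choose : ∀ {z} → R z → z ≡ x ⊎ z ≡ y
      choose Rz with two Rx Ry Rz
      ... | inj₁ x≡y        = contradiction (sym x≡y) y≢x
      ... | inj₂ (inj₁ y≡z) = inj₂ (sym y≡z)
      ... | inj₂ (inj₂ x≡z) = inj₁ (sym x≡z)
    ... | no none = x , Rx , λ {z} Rz → inj₁ (decidable-stable (z ≟ x) (λ z≢x → none (z , Rz , z≢x)))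

    module _ {p q : Fin 3} (p≢q : p ≢ q) (x : Fin n) where
      open Rotate p≢q x

      segment : ∀ j d → (∀ i → j ≤ i → i ≤ j + d → ¬ R (odd i)) → (∀ i → j < i → i ≤ j + d → ¬ R (even i)) → Joined (odd j) (odd (j + d))
      segment j zero    ¬odd ¬even = subst (Joined (odd j) ∘ odd) (sym (+-identityʳ j)) ε
      segment j (suc d) ¬odd ¬even rewrite +-suc j d =
        segment j d (λ i l u → ¬odd i l (m≤n⇒m≤1+n u)) (λ i l u → ¬even i l (m≤n⇒m≤1+n u)) ◅◅
        (¬odd (j + d) (m≤m+n j d) (n≤1+n _) , ¬new , q , refl) ◅
        (¬new , ¬odd (suc (j + d)) (m≤n⇒m≤1+n (m≤m+n j d)) ≤-refl , p , refl) ◅ ε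
        where
        ¬new = ¬even (suc (j + d)) (s≤s (m≤m+n j d)) ≤-refl

      -- The bicoloured cycle with `x`, which is `even 0`, left out: a path from `act p x` to
      -- `act q x`.
      OnPath : Fin n → Set
      OnPath y = Σ[ i ∈ Fin N ] (odd (toℕ i) ≡ y ⊎ (0 < toℕ i × even (toℕ i) ≡ y))

      onPath? : ∀ y → Dec (OnPath y)
      onPath? y = any? (λ i → (odd (toℕ i) ≟ y) ⊎-dec ((0 <? toℕ i) ×-dec (even (toℕ i) ≟ y)))

      around : ∀ {y} → (∀ {z} → R z → z ≡ x ⊎ z ≡ y) → ¬ OnPath y → Joined (act p x) (act q x)
      around {y} within off with m≤n⇒∃[o]m+o≡n (≤-trans (s≤s z≤n) large)
      ... | d , 1+d≡N = subst (Joined (act p x)) (last 1+d≡N) (segment 0 d ¬odd ¬even)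
        where
        <N : ∀ {i} → i ≤ d → i < N
        <N i≤d = subst (_ <_) 1+d≡N (s≤s i≤d)
        ¬odd : ∀ i → 0 ≤ i → i ≤ d → ¬ R (odd i)
        ¬odd i _ i≤d Ri with within Ri
        ... | inj₁ eq = odd≢ i eq
        ... | inj₂ eq = off (fromℕ< (<N i≤d) , inj₁ (trans (cong odd (toℕ-fromℕ< (<N i≤d))) eq))
        ¬even : ∀ i → 0 < i → i ≤ d → ¬ R (even i)
        ¬even i 0<i i≤d Ri with within Ri
        ... | inj₁ eq = even≢ 0<i (<N i≤d) eq
        ... | inj₂ eq = off (fromℕ< (<N i≤d) , inj₂ (subst (0 <_) (sym (toℕ-fromℕ< (<N i≤d))) 0<i , trans (cong even (toℕ-fromℕ< (<N i≤d))) eq))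

      onPath-label : ∀ {y} → OnPath y → label r y ≢ label r x
      onPath-label (i , inj₁ refl)        eq = Bool.not-¬ refl (trans (sym (cong proj₁ eq)) (parity-odd (toℕ i)))
      onPath-label (i , inj₂ (0<i , refl)) eq = T-free 0<i (toℕ<n i) (trans (sym (label-even (toℕ i))) eq)

      -- Label `r` takes no value twice on the cycle. Only the two ends of the path are needed, here
      -- and in `onPath-last`.
      onPath-first : ∀ {y} → OnPath y → label r y ≡ dihedral (role r p) (label r x) → y ≡ act p x
      onPath-first (i , inj₁ refl) eq with toℕ i in i≡ | toℕ<n i
      ... | zero  | _ = refl
      ... | suc j | j<N = contradiction (trans (sym (label-even (suc j))) (dihedral-injective (role r p) (trans (sym (label-act r p _)) eq))) (T-free (s≤s z≤n) j<N)
        where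
        dihedral-injective : ∀ c {l m} → dihedral c l ≡ dihedral c m → l ≡ m
        dihedral-injective c {l} {m} eq = trans (sym (dihedral-involutive c l)) (trans (cong (dihedral c) eq) (dihedral-involutive c m))
      onPath-first (i , inj₂ (_ , refl)) eq = contradiction (trans (sym (parity-even (toℕ i))) (trans (cong proj₁ eq) (parity-flips (role r p) (role≢0 r (≢-sym r≢p)) (label r x)))) (Bool.not-¬ refl)

      onPath-last : ∀ {y} → OnPath y → label r y ≡ dihedral (role r q) (label r x) → y ≡ act q x
      onPath-last (i , inj₂ (_ , refl)) eq = contradiction (trans (sym (parity-even (toℕ i))) (trans (cong proj₁ eq) (parity-flips (role r q) (role≢0 r (≢-sym r≢q)) (label r x)))) (Bool.not-¬ refl)
      onPath-last (i , inj₁ refl) eq with suc (toℕ i) <? N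
      ... | no  1+i≮N = last (≤-antisym (toℕ<n i) (≮⇒≥ 1+i≮N))
      ... | yes 1+i<N = contradiction (trans (sym (label-even (suc (toℕ i)))) (trans (label-act r q _) (trans (cong (dihedral (role r q)) eq) (dihedral-involutive (role r q) (label r x))))) (T-free (s≤s z≤n) 1+i<N)

      -- On a cycle in the colours `e` and `s`, label `e` is fixed by `e` and switched by `s`
      -- between two values. Compared with `onPath-label` and `onPath-first`, this leaves two such
      -- paths no common vertex but an end.
      onPath-near : ∀ {e s y} → p ≡ e ⊎ p ≡ s → q ≡ e ⊎ q ≡ s → OnPath y → label e y ≡ label e x ⊎ label e y ≡ dihedral (role e s) (label e x)
      onPath-near {e} {s} p∈ q∈ = λ { (i , inj₁ refl) → near-act p∈ (near-even (toℕ i)) ; (i , inj₂ (_ , refl)) → near-even (toℕ i) }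
        where
        Near : Fin n → Set
        Near y = label e y ≡ label e x ⊎ label e y ≡ dihedral (role e s) (label e x)
        near-act : ∀ {c y} → c ≡ e ⊎ c ≡ s → Near y → Near (act c y)
        near-act {y = y} (inj₁ refl) (inj₁ eq) = inj₁ (trans (label-fixed e y) eq)
        near-act {y = y} (inj₁ refl) (inj₂ eq) = inj₂ (trans (label-fixed e y) eq)
        near-act {y = y} (inj₂ refl) (inj₁ eq) = inj₂ (trans (label-act e s y) (cong (dihedral (role e s)) eq))
        near-act {y = y} (inj₂ refl) (inj₂ eq) = inj₁ (trans (label-act e s y) (trans (cong (dihedral (role e s)) eq) (dihedral-involutive (role e s) (label e x))))
        near-even : ∀ j → Near (even j)
        near-even zero    = inj₁ refl
        near-even (suc j) = near-act q∈ (near-act p∈ (near-even j))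

    -- If the second removed vertex y lies on the pq-path from p x to q x, then it lies on
    -- neither the pr-path nor the rq-path, since these meet the former only in p x and q x.
    bypass : ∀ {p q x} → p ≢ q → R x → ¬ R (act p x) → ¬ R (act q x) → Joined (act p x) (act q x)
    bypass {p} {q} {x} p≢q Rx ¬p ¬q with y , Ry , within ← partner Rx with onPath? p≢q x y
    ... | no off = around p≢q x within off
    ... | yes on = around (≢-sym r≢p) x within off-p ◅◅ around r≢q x within off-q
      where
      open Rotate p≢q x using (r; r≢p; r≢q)
      off-p : ¬ OnPath (≢-sym r≢p) x y
      off-p on′ with onPath-near (≢-sym r≢p) x {r} {p} (inj₂ refl) (inj₁ refl) on′
      ... | inj₁ eq = onPath-label p≢q x on eq
      ... | inj₂ eq = ¬p (subst R (onPath-first p≢q x on eq) Ry)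
      off-q : ¬ OnPath r≢q x y
      off-q on′ with onPath-near r≢q x {r} {q} (inj₁ refl) (inj₂ refl) on′
      ... | inj₁ eq = onPath-label p≢q x on eq
      ... | inj₂ eq = ¬q (subst R (onPath-last p≢q x on eq) Ry)

    -- The two ends of the p-edge exhaust the removed vertices, so the rest of the pq-cycle is an
    -- intact path.
    bypass-edge : ∀ {p q x} → p ≢ q → R x → R (act p x) → Joined (act q x) (act q (act p x))
    bypass-edge {p} {q} {x} p≢q Rx Rpx with m≤n⇒∃[o]m+o≡n (≤-trans (s≤s (s≤s z≤n)) large)
    ... | d , 2+d≡N = reverse flip-step (subst (Joined (act q (act p x))) (last 2+d≡N)
        ((¬even 1 (s≤s z≤n) (s≤s z≤n) , ¬odd 1 (s≤s z≤n) (s≤s z≤n) , p , refl) ◅ segment p≢q x 1 d (λ i l → ¬odd i l) (λ i l → ¬even i (<⇒≤ l))))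
      where
      open Rotate p≢q x
      within : ∀ {z} → R z → z ≡ x ⊎ z ≡ act p x
      within Rz with two Rx Rpx Rz
      ... | inj₁ eq        = contradiction (sym eq) (act≢ p x)
      ... | inj₂ (inj₁ eq) = inj₂ (sym eq)
      ... | inj₂ (inj₂ eq) = inj₁ (sym eq)
      <N : ∀ {i} → i ≤ suc d → i < N
      <N i≤ = subst (_ <_) 2+d≡N (s≤s i≤)
      ¬odd : ∀ i → 1 ≤ i → i ≤ suc d → ¬ R (odd i)
      ¬odd i 0<i i≤ Ri with within Ri
      ... | inj₁ eq = odd≢ i eq
      ... | inj₂ eq = even≢ 0<i (<N i≤) (act-injective p eq)
      ¬even : ∀ i → 1 ≤ i → i ≤ suc d → ¬ R (even i)
      ¬even i 0<i i≤ Ri with within Ri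
      ... | inj₁ eq = even≢ 0<i (<N i≤) eq
      ... | inj₂ eq = parity-differs r (trans (parity-odd 0) (cong not (sym (parity-even i)))) (sym eq)

    joined : ∀ {u v} → ¬ R u → ¬ R v → Joined u v
    joined {u} {v} ¬u ¬v = proj₁ (follow (connected u v) ((λ _ → ε) , (λ Ru → contradiction Ru ¬u))) ¬v
      where
      -- The invariant along a walk in the whole graph. On a removed vertex it keeps all surviving
      -- neighbours within reach, so it does not matter where the walk leaves.
      Good : Fin n → Set
      Good w = (¬ R w → Joined u w) × (R w → ∀ c → ¬ R (act c w) → Joined u (act c w))
      from-one : ∀ {w d} → R w → ¬ R (act d w) → Joined u (act d w) → Good w
      from-one {w} {d} Rw ¬d path = (λ ¬w → contradiction Rw ¬w) , extend
        where
        extend : R w → ∀ c → ¬ R (act c w) → Joined u (act c w)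
        extend _ c ¬c with d ≟ c
        ... | yes refl = path
        ... | no  d≢c  = path ◅◅ bypass d≢c Rw ¬d ¬c
      advance : ∀ {w c} → Good w → Good (act c w)
      advance {w} {c} (outside , inside) with R? w | R? (act c w)
      ... | no ¬w  | no ¬cw = (λ _ → outside ¬w ◅◅ (¬w , ¬cw , c , refl) ◅ ε) , (λ Rcw → contradiction Rcw ¬cw)
      ... | yes Rw | no ¬cw = (λ _ → inside Rw c ¬cw) , (λ Rcw → contradiction Rcw ¬cw)
      ... | no ¬w  | yes Rcw = from-one Rcw (λ R′ → ¬w (subst R (involutive c w) R′)) (subst (Joined u) (sym (involutive c w)) (outside ¬w))
      -- The walk crosses an edge with both ends removed. All other vertices survive, and the detour
      -- follows the cycle in the colours `c` and `d`.
      ... | yes Rw | yes Rcw with d , d≢c ← another-colour c = from-one Rcw ¬dcw (inside Rw d ¬dw ◅◅ bypass-edge (≢-sym d≢c) Rw Rcw)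
        where
        ¬dw : ¬ R (act d w)
        ¬dw Rdw with two Rw Rcw Rdw
        ... | inj₁ eq        = act≢ c w (sym eq)
        ... | inj₂ (inj₁ eq) = d≢c (sym (act-distinct eq))
        ... | inj₂ (inj₂ eq) = act≢ d w (sym eq)
        ¬dcw : ¬ R (act d (act c w))
        ¬dcw R′ with two Rcw Rw R′
        ... | inj₁ eq        = act≢ c w eq
        ... | inj₂ (inj₁ eq) = d≢c (act-distinct (trans (cong (act d) eq) (involutive d (act c w))))
        ... | inj₂ (inj₂ eq) = act≢ d (act c w) (sym eq)
      follow : ∀ {w v} → Star _~_ w v → Good w → Good v
      follow ε                  good = good
      follow ((c , refl) ◅ path) good = follow path (advance good)

-- Composing the graph of a scheme with itself

data Trail {X : Set} (Step : Fin 3 → X → X → Set) : X → Word → X → Set where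
  []  : ∀ {x} → Trail Step x [] x
  _∷_ : ∀ {x y z c w} → Step c x y → Trail Step y w z → Trail Step x (c ∷ w) z

-- Two consecutive steps of one colour would return to the same vertex, which the injectivity of a
-- cycle forbids. Cycles therefore give closed trails along reduced words.
module Cycles {n : ℕ} (X : Graph n) (Step : Fin 3 → Fin n → Fin n → Set)
              (colour : ∀ {u v} → Graph._~_ X u v → ∃[ c ] Step c u v)
              (backtrack : ∀ {c x y z} → Step c x y → Step c y z → x ≡ z) where
  open Graph X

  second : ∀ l → (Fin (suc l) → Fin n) → Fin n → Fin n
  second zero    vertex end = end
  second (suc l) vertex end = vertex (suc zero)

  -- The final vertex is passed separately: for a cycle it is the initial vertex, which the
  -- remaining list does not contain.
  path⇒trail : ∀ l (vertex : Fin (suc l) → Fin n) end → Injective _≡_ _≡_ vertex → (∀ i → end ≢ vertex i) →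
    (∀ (i : Fin l) → vertex (inject₁ i) ~ vertex (suc i)) → vertex (fromℕ l) ~ end →
    ∃[ c ] ∃[ w ] (length w ≡ l × Reduced (c ∷ w) × Step c (vertex zero) (second l vertex end) × Trail Step (second l vertex end) w end)
  path⇒trail zero    vertex end inj fresh edges closing with c , s ← colour closing = c , [] , refl , [-] , s , []
  path⇒trail (suc l) vertex end inj fresh edges closing
    with c , s ← colour (edges zero)
       | d , w , len , red , t , trail ← path⇒trail l (vertex ∘ suc) end (Fin-suc-injective ∘ inj) (fresh ∘ suc) (edges ∘ suc) closing =
    c , d ∷ w , cong suc len , c≢d ∷ red , s , t ∷ trail
    where
    distinct : ∀ l (vertex : Fin (suc (suc l)) → Fin n) → Injective _≡_ _≡_ vertex → (∀ i → end ≢ vertex i) → vertex zero ≢ second l (vertex ∘ suc) end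
    distinct zero    vertex inj fresh eq = fresh zero (sym eq)
    distinct (suc l) vertex inj fresh eq = contradiction (inj eq) λ ()
    c≢d : c ≢ d
    c≢d refl = distinct l vertex inj fresh (backtrack s t)

  cycle⇒trail : ∀ {l} → Cycle X l → ∃[ x ] ∃[ c ] ∃[ w ] (suc (length w) ≡ l × Reduced (c ∷ w) × Trail Step x (c ∷ w) x)
  cycle⇒trail (cycle {suc zero} _ (s≤s (s≤s ())) _ _ _)
  cycle⇒trail (cycle {zero} _ (s≤s ()) _ _ _)
  cycle⇒trail (cycle {suc (suc l)} vertex _ inj edges closing)
    with c , s ← colour (edges zero)
       | d , w , len , red , t , trail ← path⇒trail (suc l) (vertex ∘ suc) (vertex zero) (Fin-suc-injective ∘ inj) (λ i eq → contradiction (inj eq) λ ()) (edges ∘ suc) closing =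
    vertex zero , c , d ∷ w , cong (λ m → suc (suc m)) len , c≢d ∷ red , s ∷ t ∷ trail
    where
    c≢d : c ≢ d
    c≢d refl = contradiction (inj (backtrack s t)) λ ()

three-in-two : ∀ {m} → m < 3 → (i j l : Fin m) → i ≡ j ⊎ j ≡ l ⊎ i ≡ l
three-in-two {1} _ zero       zero       _          = inj₁ refl
three-in-two {2} _ zero       zero       _          = inj₁ refl
three-in-two {2} _ zero       (suc zero) zero       = inj₂ (inj₂ refl)
three-in-two {2} _ zero       (suc zero) (suc zero) = inj₂ (inj₁ refl)
three-in-two {2} _ (suc zero) (suc zero) _          = inj₁ refl
three-in-two {2} _ (suc zero) zero       zero       = inj₂ (inj₁ refl)
three-in-two {2} _ (suc zero) zero       (suc zero) = inj₂ (inj₂ refl)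
three-in-two {suc (suc (suc _))} (s≤s (s≤s (s≤s ())))

small-subset : ∀ {n} (S : Subset n) → ∣ S ∣ < 3 → AtMostTwo (_∈ S)
small-subset S small x∈ y∈ z∈ with index x∈ | index y∈ | index z∈
  where
  open Enumeration (enumerate (lookup S))
  index : ∀ {x} → x ∈ S → ∃[ i ] elem i ≡ x
  index x∈ = complete _ ([]=⇒lookup x∈)
... | i , refl | j , refl | l , refl with three-in-two (subst (_< 3) ∣ S ∣-sum small) i j l
...   | inj₁ refl        = inj₁ refl
...   | inj₂ (inj₁ refl) = inj₂ (inj₁ refl)
...   | inj₂ (inj₂ refl) = inj₂ (inj₂ refl)

module SelfComposite {g k : ℕ} (scheme : Scheme g (suc k)) where
  open Scheme scheme renaming (root to a)
  open SchemeGraph scheme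
  open Graph graph using (_~_)

  -- The vertex that loses its edge of colour `c` when the root is deleted.
  socket : Fin 3 → Fin k
  socket c = punchOut (≢-sym (act≢ c a))

  punchIn-socket : ∀ c → punchIn a (socket c) ≡ act c a
  punchIn-socket c = punchIn-punchOut (≢-sym (act≢ c a))

  socket-injective : ∀ {c d} → socket c ≡ socket d → c ≡ d
  socket-injective {c} {d} eq = act-distinct (trans (sym (punchIn-socket c)) (trans (cong (punchIn a) eq) (punchIn-socket d)))

  at-socket : ∀ {c i} → act c (punchIn a i) ≡ a → i ≡ socket c
  at-socket {c} {i} eq = punchIn-injective a i (socket c) (trans (act-injective c (trans eq (sym (involutive c a)))) (sym (punchIn-socket c)))

  -- An edge of colour `c` is attached to socket `c` at both ends. It replaces the two lost c-edges,
  -- and the composite inherits the 3-colouring.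
  port : Fin (suc k) → Fin (suc k) → Fin k
  port u v with any? (λ c → act c u ≟ v)
  ... | yes (c , _) = socket c
  ... | no _        = socket zero

  port-act : ∀ c {u v} → act c u ≡ v → port u v ≡ socket c
  port-act c {u} {v} eq with any? (λ c → act c u ≟ v)
  ... | yes (d , eq′) = cong socket (act-distinct (trans eq′ (sym eq)))
  ... | no none       = contradiction (c , eq) none

  linking : Linking graph (graph ∖ a)
  linking = record
    { port = port
    ; port-degree = λ { (c , eq) → subst (λ i → Graph.degree (graph ∖ a) i ≡ 2) (sym (port-act c eq))
        (adjacent⇒degree2 graph cubic a (c , trans (cong (act c) (punchIn-socket c)) (involutive c a))) }
    ; port-unique = unique
    }
    where
    unique : ∀ u x → Graph.degree (graph ∖ a) x ≡ 2 → ∃! _≡_ (λ v → u ~ v × port u v ≡ x)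
    unique u x d with c , eq ← degree2⇒adjacent graph cubic a d =
      act c u , ((c , refl) , trans (port-act c refl) (sym (at-socket eq))) ,
      λ { ((c′ , refl) , p) → cong (λ e → act e u) (socket-injective (trans (sym (at-socket eq)) (trans (sym p) (port-act c′ refl)))) }

  H : Graph (suc k * k)
  H = compose graph (graph ∖ a) linking
  module H = Graph H

  crossing : ∀ c u → combine u (socket c) H.~ combine (act c u) (socket c)
  crossing c u = subst (λ j → combine u (socket c) H.~ combine (act c u) j) (port-act c (involutive c u))
    (cross graph cubic a graph linking {u} {act c u} (c , refl) (port-act c refl))

  along : ∀ u c {i j} → act c (punchIn a i) ≡ punchIn a j → combine u i H.~ combine u j
  along u c {i} {j} eq = inner graph cubic a graph linking u {i} {j} (c , eq)

  -- 3-connectedness of the composite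

  module Connectivity (R : Fin (suc k * k) → Set) (R? : ∀ x → Dec (R x)) (two : AtMostTwo R) where

    Removed : Fin (suc k) → Fin k → Set
    Removed u i = R (combine u i)

    Joined : Fin (suc k) → Fin k → Fin (suc k) → Fin k → Set
    Joined u i v j = Star (λ x y → ¬ R x × ¬ R y × x H.~ y) (combine u i) (combine v j)

    Dirty : Fin (suc k) → Set
    Dirty u = ∃[ i ] Removed u i

    dirty? : ∀ u → Dec (Dirty u)
    dirty? u = any? (λ i → R? (combine u i))

    two-dirty : AtMostTwo Dirty
    two-dirty {u} {v} {w} (i , Ri) (j , Rj) (l , Rl) with two Ri Rj Rl
    ... | inj₁ eq        = inj₁ (combine-injectiveˡ u i v j eq)
    ... | inj₂ (inj₁ eq) = inj₂ (inj₁ (combine-injectiveˡ v j w l eq))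
    ... | inj₂ (inj₂ eq) = inj₂ (inj₂ (combine-injectiveˡ u i w l eq))

    module _ (u : Fin (suc k)) where

      Image : Fin (suc k) → Set
      Image x = ∃[ i ] (x ≡ punchIn a i × Removed u i)

      image? : ∀ x → Dec (Image x)
      image? x = any? (λ i → (x ≟ punchIn a i) ×-dec R? (combine u i))

      two-image : AtMostTwo Image
      two-image (i , refl , Ri) (j , refl , Rj) (l , refl , Rl) with two Ri Rj Rl
      ... | inj₁ eq        = inj₁ (cong (punchIn a) (combine-injectiveʳ u i u j eq))
      ... | inj₂ (inj₁ eq) = inj₂ (inj₁ (cong (punchIn a) (combine-injectiveʳ u j u l eq)))
      ... | inj₂ (inj₂ eq) = inj₂ (inj₂ (cong (punchIn a) (combine-injectiveʳ u i u l eq)))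

      -- The factor minus the at most two images still contains a path to the root. Its last vertex
      -- before the root is a socket.
      to-socket : ∀ {i} → ¬ Removed u i → ∃[ c ] (¬ Removed u (socket c) × Joined u i u (socket c))
      to-socket {i} ¬i = follow (joined ¬image ¬root) i refl
        where
        open Removal Image image? two-image using (Step; joined)
        ¬image : ¬ Image (punchIn a i)
        ¬image (j , eq , Rj) = ¬i (subst (Removed u) (sym (punchIn-injective a i j eq)) Rj)
        ¬root : ¬ Image a
        ¬root (j , eq , _) = punchInᵢ≢i a j (sym eq)
        follow : ∀ {x} → Star Step x a → ∀ i → x ≡ punchIn a i → ∃[ c ] (¬ Removed u (socket c) × Joined u i u (socket c))
        follow ε i eq = contradiction (sym eq) (punchInᵢ≢i a i)
        follow (_◅_ {j = z} (¬x , ¬z , c , eq) path) i refl with a ≟ z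
        ... | yes refl = c , subst (λ j → ¬ Removed u j × Joined u i u j) (at-socket eq) ((λ Ri → ¬x (i , refl , Ri)) , ε)
        ... | no a≢z with j ← punchOut a≢z | refl ← punchIn-punchOut a≢z with d , ¬d , walk ← follow path j refl =
          d , ¬d , ((λ Ri → ¬x (i , refl , Ri)) , (λ Rj → ¬z (j , refl , Rj)) , along u c eq) ◅ walk

      -- Here the root counts as removed as well, which leaves room for only one removed vertex in
      -- the copy.
      within-copy : (∀ {i j} → Removed u i → Removed u j → i ≡ j) → ∀ {i j} → ¬ Removed u i → ¬ Removed u j → Joined u i u j
      within-copy one {i} {j} ¬i ¬j = follow (joined (¬blocked ¬i) (¬blocked ¬j)) i refl refl
        where
        Blocked : Fin (suc k) → Set
        Blocked x = x ≡ a ⊎ Image x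
        one-image : ∀ {x y} → Image x → Image y → x ≡ y
        one-image (i , refl , Ri) (j , refl , Rj) = cong (punchIn a) (one Ri Rj)
        two-blocked : AtMostTwo Blocked
        two-blocked (inj₁ p) (inj₁ q) _        = inj₁ (trans p (sym q))
        two-blocked (inj₁ p) (inj₂ q) (inj₁ r) = inj₂ (inj₂ (trans p (sym r)))
        two-blocked (inj₁ p) (inj₂ q) (inj₂ r) = inj₂ (inj₁ (one-image q r))
        two-blocked (inj₂ p) (inj₁ q) (inj₁ r) = inj₂ (inj₁ (trans q (sym r)))
        two-blocked (inj₂ p) (inj₁ q) (inj₂ r) = inj₂ (inj₂ (one-image p r))
        two-blocked (inj₂ p) (inj₂ q) _        = inj₁ (one-image p q)
        open Removal Blocked (λ x → (x ≟ a) ⊎-dec image? x) two-blocked using (Step; joined)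
        ¬blocked : ∀ {i} → ¬ Removed u i → ¬ Blocked (punchIn a i)
        ¬blocked {i} ¬i (inj₁ eq) = punchInᵢ≢i a i eq
        ¬blocked {i} ¬i (inj₂ (j , eq , Rj)) = ¬i (subst (Removed u) (sym (punchIn-injective a i j eq)) Rj)
        follow : ∀ {x y} → Star Step x y → ∀ i {j} → x ≡ punchIn a i → y ≡ punchIn a j → Joined u i u j
        follow ε i {j} refl eq with refl ← punchIn-injective a i j eq = ε
        follow (_◅_ {j = z} (¬x , ¬z , c , eq) path) i refl end with a ≟ z
        ... | yes refl = contradiction (inj₁ refl) ¬z
        ... | no a≢z with l ← punchOut a≢z | refl ← punchIn-punchOut a≢z =
          ((λ Ri → ¬x (inj₂ (i , refl , Ri))) , (λ Rl → ¬z (inj₂ (l , refl , Rl))) , along u c eq) ◅ follow path l refl end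

    cross-over : ∀ c u → ¬ Removed u (socket c) → ¬ Removed (act c u) (socket c) → Joined u (socket c) (act c u) (socket c)
    cross-over c u ¬u ¬v = (¬u , ¬v , crossing c u) ◅ ε

    clean : ∀ u → ¬ Dirty u → ∀ i → ¬ Removed u i
    clean _ ¬dirty i Ri = ¬dirty (i , Ri)

    -- If two removed vertices lie in the copy, all other copies are clean and any surviving socket
    -- that can be reached will do. If one does, the three exits face at most two obstacles: a
    -- removed socket and a dirty adjacent copy.
    escape : ∀ u {i} → ¬ Removed u i → ∃[ v ] ∃[ j ] (¬ Dirty v × Joined u i v j)
    escape u {i} ¬i with dirty? u
    ... | no ¬dirty = u , i , ¬dirty , ε
    ... | yes (s , Rs) with any? (λ t → R? (combine u t) ×-dec ¬? (s ≟ t))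
    ...   | yes (t , Rt , s≢t) with c , ¬c , walk ← to-socket u ¬i = act c u , socket c , ¬dirty , walk ◅◅ cross-over c u ¬c (clean (act c u) ¬dirty (socket c))
      where
      ¬dirty : ¬ Dirty (act c u)
      ¬dirty (j , Rj) with two Rs Rt Rj
      ... | inj₁ eq        = s≢t (combine-injectiveʳ u s u t eq)
      ... | inj₂ (inj₁ eq) = act≢ c u (sym (combine-injectiveˡ u t (act c u) j eq))
      ... | inj₂ (inj₂ eq) = act≢ c u (sym (combine-injectiveˡ u s (act c u) j eq))
    ...   | no single with any? (λ c → ¬? (dirty? (act c u)) ×-dec ¬? (R? (combine u (socket c))))
    ...     | yes (c , ¬dirty , ¬c) = act c u , socket c , ¬dirty , within-copy u one ¬i ¬c ◅◅ cross-over c u ¬c (clean (act c u) ¬dirty (socket c))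
      where
      only : ∀ {j} → Removed u j → s ≡ j
      only {j} Rj = decidable-stable (s ≟ j) (λ s≢j → single (j , Rj , s≢j))
      one : ∀ {i j} → Removed u i → Removed u j → i ≡ j
      one Ri Rj = trans (sym (only Ri)) (only Rj)
    ...     | no stuck = contradiction (bad zero) (pigeonhole (bad (suc zero)) (bad (suc (suc zero))))
      where
      only : ∀ {j} → Removed u j → s ≡ j
      only {j} Rj = decidable-stable (s ≟ j) (λ s≢j → single (j , Rj , s≢j))
      Bad : Fin 3 → Set
      Bad c = Dirty (act c u) ⊎ Removed u (socket c)
      bad : ∀ c → Bad c
      bad c with dirty? (act c u) | R? (combine u (socket c))
      ... | yes dirty | _     = inj₁ dirty
      ... | no _      | yes r = inj₂ r
      ... | no ¬dirty | no ¬c = contradiction (c , ¬dirty , ¬c) stuck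
      dirty-once : ∀ {c d} → Dirty (act c u) → Dirty (act d u) → c ≡ d
      dirty-once {c} {d} p q with two-dirty (s , Rs) p q
      ... | inj₁ eq        = contradiction (sym eq) (act≢ c u)
      ... | inj₂ (inj₁ eq) = act-distinct eq
      ... | inj₂ (inj₂ eq) = contradiction (sym eq) (act≢ d u)
      removed-once : ∀ {c d} → Removed u (socket c) → Removed u (socket d) → c ≡ d
      removed-once p q = socket-injective (trans (sym (only p)) (only q))
      pigeonhole : Bad (suc zero) → Bad (suc (suc zero)) → ¬ Bad zero
      pigeonhole (inj₁ p) (inj₁ q) _        = contradiction (dirty-once p q) λ ()
      pigeonhole (inj₂ p) (inj₂ q) _        = contradiction (removed-once p q) λ ()
      pigeonhole (inj₁ p) (inj₂ q) (inj₁ r) = contradiction (dirty-once p r) λ ()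
      pigeonhole (inj₁ p) (inj₂ q) (inj₂ r) = contradiction (removed-once q r) λ ()
      pigeonhole (inj₂ p) (inj₁ q) (inj₁ r) = contradiction (dirty-once q r) λ ()
      pigeonhole (inj₂ p) (inj₁ q) (inj₂ r) = contradiction (removed-once p r) λ ()

    -- Lifts a walk in the outer graph that avoids the at most two dirty vertices.
    between-clean : ∀ u v → ¬ Dirty u → ¬ Dirty v → ∀ i j → Joined u i v j
    between-clean u v ¬u ¬v = follow u v (joined ¬u ¬v) ¬u
      where
      open Removal Dirty dirty? two-dirty using (Step; joined)
      inside : ∀ u → ¬ Dirty u → ∀ i j → Joined u i u j
      inside u ¬u i j = within-copy u (λ {i} Ri → contradiction Ri (clean u ¬u i)) (clean u ¬u i) (clean u ¬u j)
      follow : ∀ u v → Star Step u v → ¬ Dirty u → ∀ i j → Joined u i v j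
      follow u .u ε ¬u i j = inside u ¬u i j
      follow u v ((_ , ¬z , c , refl) ◅ path) ¬u i j =
        inside u ¬u i (socket c) ◅◅ cross-over c u (clean u ¬u (socket c)) (clean (act c u) ¬z (socket c)) ◅◅ follow (act c u) v path ¬z (socket c) j

    all-joined : ∀ u i v j → ¬ Removed u i → ¬ Removed v j → Joined u i v j
    all-joined u i v j ¬i ¬j with u′ , i′ , ¬u′ , p ← escape u ¬i | v′ , j′ , ¬v′ , q ← escape v ¬j =
      p ◅◅ between-clean u′ v′ ¬u′ ¬v′ i′ j′ ◅◅ reverse (λ (¬x , ¬y , e) → ¬y , ¬x , H.~-sym e) q

  three-connected : 3 < suc k * k → KConnected 3 H
  three-connected 3<H = 3<H , λ S small x y x∉ y∉ →
    subst₂ (Walk-avoiding H S) (combine-remQuot {suc k} k x) (combine-remQuot {suc k} k y)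
      (Connectivity.all-joined (_∈ S) (_∈? S) (small-subset S small) (quotient k x) (remainder {suc k} k x) (quotient k y) (remainder {suc k} k y)
        (subst (_∉ S) (sym (combine-remQuot {suc k} k x)) x∉) (subst (_∉ S) (sym (combine-remQuot {suc k} k y)) y∉))

  -- Girth of the composite

  copy : Fin (suc k * k) → Fin (suc k)
  copy = quotient k

  place : Fin (suc k * k) → Fin k
  place = remainder {suc k} k

  data Step (c : Fin 3) (x y : Fin (suc k * k)) : Set where
    stay : copy x ≡ copy y → act c (punchIn a (place x)) ≡ punchIn a (place y) → Step c x y
    pass : act c (copy x) ≡ copy y → place x ≡ socket c → place y ≡ socket c → Step c x y

  step-colour : ∀ {x y} → x H.~ y → ∃[ c ] Step c x y
  step-colour (inj₁ (e , c , eq)) = c , stay e eq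
  step-colour {x} {y} (inj₂ ((c , eq) , p , q)) = c , pass eq (trans (sym p) (port-act c eq))
    (trans (sym q) (port-act c (trans (cong (act c) (sym eq)) (involutive c (copy x)))))

  -- The c-edge at socket `c` leads to the deleted root. So a step inside a copy and an added edge
  -- of the same colour never share a vertex, and the steps of one colour form a matching.
  no-stay : ∀ {c i j} → i ≡ socket c → act c (punchIn a i) ≢ punchIn a j
  no-stay {c} {i} {j} refl eq = punchInᵢ≢i a j (sym (trans (sym (trans (cong (act c) (punchIn-socket c)) (involutive c a))) eq))

  step-backtrack : ∀ {c x y z} → Step c x y → Step c y z → x ≡ z
  step-backtrack {c} {x} {y} {z} (stay p e) (stay q f) = remQuot-injective x z (trans p q)
    (punchIn-injective a _ _ (trans (sym (involutive c _)) (trans (cong (act c) e) f)))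
  step-backtrack {c} {x} {y} {z} (pass p e _) (pass q _ f) = remQuot-injective x z (trans (sym (involutive c _)) (trans (cong (act c) p) q)) (trans e (sym f))
  step-backtrack {c} {x} {y} {z} (stay _ e) (pass _ f _) = contradiction (trans (cong (act c) (sym e)) (involutive c _)) (no-stay f)
  step-backtrack {c} {x} {y} {z} (pass _ _ f) (stay _ e) = contradiction e (no-stay f)

  -- A reduced trail either stays in its copy or projects to a nonempty reduced word in G.
  data Outcome (x y : Fin (suc k * k)) (w : Word) : Set where
    inside  : copy x ≡ copy y → run act w (punchIn a (place x)) ≡ punchIn a (place y) → Outcome x y w
    through : ∀ pre c post → w ≡ pre ++ c ∷ post → run act pre (punchIn a (place x)) ≡ act c a →
              ∀ cs → Reduced (c ∷ cs) → length cs ≤ length post → run act (c ∷ cs) (copy x) ≡ copy y → Outcome x y w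

  -- The projected word is reduced: between two successive crossings of equal colour the trail would
  -- either turn back at once or run from a socket to itself inside a copy, giving a short closed
  -- reduced word in the factor.
  outcome : ∀ {x y w} → Reduced w → length w ≤ g → Trail Step x w y → Outcome x y w
  outcome _ _ [] = inside refl refl
  outcome {x} {y} {c ∷ w} red len (_∷_ {y = z} (stay p e) trail) with outcome (reduced-tail red) (<⇒≤ len) trail
  ... | inside q f = inside (trans p q) (trans (cong (run act w) e) f)
  ... | through pre d post refl r cs redcs l f = through (c ∷ pre) d post refl (trans (cong (run act pre) e) r) cs redcs l
          (trans (cong (run act (d ∷ cs)) p) f)
  outcome {x} {y} {c ∷ w} red len (_∷_ {y = z} (pass p e e′) trail) with outcome (reduced-tail red) (<⇒≤ len) trail
  ... | inside q f = through [] c w refl (trans (cong (punchIn a) e) (punchIn-socket c)) [] [-] z≤n (trans p q)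
  ... | through pre d post refl r cs redcs l f = through [] c w refl (trans (cong (punchIn a) e) (punchIn-socket c)) (d ∷ cs) (c≢d pre red len r ∷ redcs)
          (≤-trans (s≤s l) (≤-trans (m≤n+m _ (length pre)) (≤-reflexive (sym (length-++ pre)))))
          (trans (cong (run act (d ∷ cs)) p) f)
    where
    c≢d : ∀ pre → Reduced (c ∷ pre ++ d ∷ post) → length (c ∷ pre ++ d ∷ post) ≤ g → run act pre (punchIn a (place z)) ≡ act d a → c ≢ d
    c≢d []        (c≢d ∷ _) _   _ = c≢d
    c≢d (b ∷ pre) (_ ∷ red) len r refl = free b pre (reduced-prefix (b ∷ pre) red)
      (≤-trans (s≤s (≤-trans (m≤m+n (length pre) _) (≤-reflexive (sym (length-++ pre))))) (<⇒≤ len)) (act c a)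
      (trans (cong (run act (b ∷ pre)) (sym (trans (cong (punchIn a) e′) (punchIn-socket c)))) r)

  -- A short cycle would yield a short closed reduced word inside a copy or, after projection, in
  -- the outer graph, and `free` excludes both.
  girth : GirthAtLeast g H
  girth l cyc with x , c , w , refl , red , trail ← Cycles.cycle⇒trail H Step step-colour step-backtrack cyc with suc (length w) ≤? g
  ... | no long = <⇒≤ (≰⇒> long)
  ... | yes short with outcome red short trail
  ...   | inside _ f = contradiction f (free c w red short _)
  ...   | through pre d post eq _ cs redcs len f = contradiction f (free d cs redcs
            (≤-trans (s≤s len) (≤-trans (m≤n+m (suc (length post)) (length pre))
              (≤-trans (≤-reflexive (trans (sym (length-++ pre)) (cong length (sym eq)))) short))) (copy x))

open import Data.Integer using (+_; _-_) renaming (_≥_ to _≥ℤ_)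

theorem5p22 : (∀ (g m : ℕ) → g ≥ 3 → m ≥ 1 →
    Σ[ n ∈ ℕ ] Σ[ k ∈ ℕ ] Σ[ G ∈ Graph n ] Σ[ A ∈ Graph (suc k) ]
    Σ[ a ∈ Fin (suc k) ] Σ[ L ∈ Linking G (A ∖ a) ]
    (let H = compose G (A ∖ a) L in
    Cubic G × Cubic A ×
    KConnected 3 H × Cubic H × GirthAtLeast g H ×
    (Σ[ c ∈ ℕ ] (IsC₂ H c × (+ c - ceiling (+ (n * k + 2) / 4)) ≥ℤ + m))))
    ×
    (∀ {n k : ℕ} (G : Graph n) (A : Graph (suc k)) (a : Fin (suc k))
    (L : Linking G (A ∖ a)) → Cubic G → Cubic A →
    Class1 (compose G (A ∖ a) L) ⇔ (Class1 G × Class1 A))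
theorem5p22 = existence , λ G A a L cubic-G cubic-A → class1⇔ A cubic-A a G L cubic-G
  where
  existence : ∀ (g m : ℕ) → g ≥ 3 → m ≥ 1 →
    Σ[ n ∈ ℕ ] Σ[ k ∈ ℕ ] Σ[ G ∈ Graph n ] Σ[ A ∈ Graph (suc k) ]
    Σ[ a ∈ Fin (suc k) ] Σ[ L ∈ Linking G (A ∖ a) ]
    (let H = compose G (A ∖ a) L in
    Cubic G × Cubic A ×
    KConnected 3 H × Cubic H × GirthAtLeast g H ×
    (Σ[ c ∈ ℕ ] (IsC₂ H c × (+ c - ceiling (+ (n * k + 2) / 4)) ≥ℤ + m)))
  -- The added `4 * m + 2` is there for the order: the parameter of the scheme lies below `N`, and
  -- `N ≤ n`, while `gap` asks for `4 * m + 2 ≤ n`.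
  existence g m g≥3 _ = build (Construction.scheme (g + (4 * m + 2)))
    where
    build : ∃[ n ] Scheme (g + (4 * m + 2)) n → _
    build (zero , scheme) with () ← Scheme.root scheme
    build (suc k , scheme) with SchemeGraph.order-divisible scheme
    ... | zero  , ()
    ... | suc j , n≡4K = suc k , k , graph , graph , Scheme.root scheme , linking , cubic , cubic ,
        three-connected 3<H , compose-cubic graph cubic (Scheme.root scheme) graph linking ,
        (λ l cyc → ≤-trans (m≤m+n g _) (girth l cyc)) ,
        c , isC₂ , gap (suc k) k j m c k≡4j+3 (≤-trans (m≤n+m _ g) large)
          (LowerBound.conversion-bound graph graph (Scheme.root scheme) linking cubic j k≡4j+3 c isC₂)
      where
      open SchemeGraph scheme
      open SelfComposite scheme
      large : g + (4 * m + 2) ≤ suc k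
      large = ≤-trans (≤-trans (n≤1+n _) (<⇒≤ (Scheme.large scheme))) N≤n
      k≡4j+3 : k ≡ 4 * j + 3
      k≡4j+3 = suc-injective (trans n≡4K (trans (*-suc 4 j) (trans (+-comm 4 (4 * j)) (+-suc (4 * j) 3))))
      3≤k : 3 ≤ k
      3≤k = ≤-trans (m≤n+m 3 (4 * j)) (≤-reflexive (sym k≡4j+3))
      3<H : 3 < suc k * k
      3<H = *-mono-≤ (s≤s 3≤k) (≤-trans (s≤s z≤n) 3≤k)
      c : ℕ
      c = proj₁ (c₂-exists H)
      isC₂ : IsC₂ H c
      isC₂ = proj₂ (c₂-exists H)
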